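{- Let $N=(S,T,F,M_0,\ell)$ be a Petri net and $N'=(S',T',F',M'_0,\ell')$ a plain Petri net with $S'\subseteq S$ and $M'_0=M_0\restriction S'$. Suppose there exist sets $T^+\subseteq T$ and $T^-\subseteq T$ and a class $\mathit{NF}\subseteq\mathbb Z^T$ such that 1. $F\restriction(S\cup T^+)$ is acyclic. 2. $F\restriction(S\cup T^-)$ is acyclic. 3. For every $t\in T$ with $\ell(t)\ne\tau$ there is $t'\in T'$ with $\ell'(t')=\ell(t)$ such that ${}^\bullet t'\le{}^*t$ and there is a finite $G\in\mathbb N^T$ with $\ell(G)\equiv\emptyset$ and $[\![t']\!]=[\![t+G]\!]$. Here ${}^*t$ is the multiset of faithful origins of $t$ w.r.t. $T^+$ and $S'\cup\{s\in S\mid M_0(s)>0\}$. 4. There exists a function $f:T\to\mathbb N$ with $f(t)>0$ for all $t\in T$, extended to finite $G\in\mathbb Z^T$ by $f(G)=\sum_{t}G(t)f(t)$, such that for each finite $G\in\mathbb Z^T$ with $\ell(G)\equiv\emptyset$ there is a finite $H\in\mathit{NF}$ with $\ell(H)\equiv\emptyset$, $[\![H]\!]=[\![G]\!]$ and $f(H)=f(G)$. 5. For every $M'\in\mathbb N^{S'}$ and all finite $U'\in\mathbb N^{T'}$, $U\in\mathbb N^T$ with $\ell(U)=\ell'(U')$ and $M'+{}^\bullet U'\in[M'_0\rangle_{N'}$, there is a finite $H_{M',U}\in\mathbb N^{T^+}$ with $\ell(H_{M',U})\equiv\emptyset$, such that for each finite $H\in\mathit{NF}$ with $M:=M'+{}^\bullet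 U'+(M_0-M'_0)+[\![H]\!]-{}^\bullet U\in\mathbb N^S$ and $M+{}^\bullet U\in[M_0\rangle_N$: (a) $M_{M',U}:=M'+{}^\bullet U'+(M_0-M'_0)+[\![H_{M',U}]\!]-{}^\bullet U\in\mathbb N^S$, (b) if $M'\xrightarrow{a}$ with $a\in\mathrm{Act}$ then $M_{M',U}\xrightarrow{a}$, (c) $H\le H_{M',U}$, (d) if $H(u)<0$ then $u\in T^-$, (e) if $H(u)<0$ and $H(t)>0$ then ${}^\bullet u\cap{}^\bullet t=\emptyset$, (f) if $H(u)<0$ and $(M+{}^\bullet U)[t\rangle$ with $\ell(t)\ne\tau$ then ${}^\bullet u\cap{}^\bullet t=\emptyset$, (g) if $(M+{}^\bullet U)[\{t\}+\{u\}\rangle$ and $t',u'\in T'$ with $\ell'(t')=\ell(t)$ and $\ell'(u')=\ell(u)$, then ${}^\bullet t'\cap{}^\bullet u'=\emptyset$. Then $N\approx^\Delta_{bSTb}N'$.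
   Context: **Multisets and Petri nets.** Let $\mathrm{Act}$ be a set of visible actions, $\tau\notin\mathrm{Act}$ the invisible action, $\mathrm{Act}_\tau=\mathrm{Act}\cup\{\tau\}$. A signed multiset over $X$ is a function $A:X\to\mathbb Z$; a multiset has values in $\mathbb N$. $\le,+,-$ are pointwise; $\cap$ is pointwise min, $x\in A$ iff $A(x)\ne0$, $\emptyset$ is the zero multiset; $A$ is finite iff $\sum_x|A(x)|<\infty$. (Signed) multisets over a subset of a set are identified with their extension by $0$; elements are identified with singleton multisets where convenient ($t+G$ means $\{t\}+G$). A (labelled) Petri net is $N=(S,T,F,M_0,\ell)$ with $S,T$ disjoint sets (places, transitions), $F:(S\times T\cup T\times S)\to\mathbb N$, $M_0:S\to\mathbb N$, $\ell:T\to\mathrm{Act}_\tau$. It is *plain* iff $\ell$ is injective and never $\tau$. Markings are multisets $M\in\mathbb N^S$. ${}^\bullet x(y)=F(y,x)$, $x^\bullet(y)=F(x,y)$, $[\![t]\!]=t^\bullet-{}^\bullet t$ for transitions $t$; these, and $\ell$ (with $\ell(G)=\sum_tG(t)\cdot\{\ell(t)\}$), extend additively to finite signed multisets of transitions. For transitions of $N'$ these are computed in $N'$. $\ell(G)\equiv\emptyset$ means that $\ell(t)=\tau$ for all $t$ with $G(t)\ne0$. For non-empty finite $G\in\mathbb N^T$: $M[G\rangle M'$ iff ${}^\bullet G\le M$ and $M'=M+[\![G]\!]$; $M[G\rangle$ iff $\exists M'.\,M[G\rangle M'$; $M[t\rangle$ is $M[\{t\}\rangle$. $[M_0\rangle_N$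 is the smallest set of markings containing $M_0$ and closed under steps. $M\xrightarrow{\alpha}M'$ iff $M[t\rangle M'$ for some $t$ with $\ell(t)=\alpha$; $M\xrightarrow{\alpha}$ iff such $M'$ exists. **Faithful origins.** Let $T^+\subseteq T$, $S^+\subseteq S$. A path in $N$ is an alternating sequence $\pi=x_0x_1\cdots x_n$ of places and transitions with $F(x_i,x_{i+1})>0$ for $0\le i<n$; its arc weight is $F(\pi)=\prod_{i=0}^{n-1}F(x_i,x_{i+1})$. $F\restriction(S\cup T^+)$ is acyclic iff there is no path $x_0\cdots x_n$ with $n\ge1$, $x_0=x_n$ and all nodes in $S\cup T^+$ (likewise for $T^-$). A place $s$ is faithful w.r.t. $T^+$ and $S^+$ iff $|\{s\}\cap S^+|+\sum_{t\in T^+}F(t,s)=1$. A path $x_0\cdots x_n$ is faithful iff all $x_i$ with $0\le i<n$ are transitions in $T^+$ or faithful places. For $x\in S\cup T$, ${}^*x\in(\mathbb N\cup\{\infty\})^{S^+}$ is given by ${}^*x(s)=\sup\{F(\pi)\mid\pi\text{ a faithful path from }s\in S^+\text{ to }x\}$ ($0$ if there is no such path). **ST-LTS.** An ST-marking of $N$ is a pair $(M,U)\in\mathbb N^S\times T^*$; the initial one is $(M_0,\varepsilon)$. $(M,U)\xrightarrow{a^+}(M',U')$ iff there is $t$ with $\ell(t)=a$, $M[t\rangle$, $M'=M-{}^\bullet t$, $U'=Ut$; $(M,U)\xrightarrow{a^{ -n}}(M',U')$ ($a\in\mathrm{Act}$, $n>0$) iff the $n$-th element $t$ of $U$ exists and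 has $\ell(t)=a$, $U'$ is $U$ with the $n$-th element removed, $M'=M+t^\bullet$; $(M,U)\xrightarrow{\tau}(M',U')$ iff $M\xrightarrow{\tau}M'$ and $U'=U$. The ST-LTS of $N$ has the ST-markings as states. **Branching bisimilarity with explicit divergence.** For labelled transition systems (LTSs), $\Longrightarrow$ is the reflexive transitive closure of $\xrightarrow{\tau}$, and $p\xrightarrow{(\alpha)}p'$ means $p\xrightarrow{\alpha}p'$ or ($\alpha=\tau$ and $p=p'$). A branching bisimulation between two LTSs is a relation $\mathcal B$ between their states such that initial states are related; if $p\,\mathcal B\,q$ and $p\xrightarrow{\alpha}p'$ then $q\Longrightarrow q^\dagger\xrightarrow{(\alpha)}q'$ for some $q^\dagger,q'$ with $p\,\mathcal B\,q^\dagger$, $p'\,\mathcal B\,q'$; and symmetrically. The LTSs are branching bisimilar with explicit divergence iff there is such a $\mathcal B$ satisfying moreover: if $p\,\mathcal B\,q$ and $p=p_0\xrightarrow{\tau}p_1\xrightarrow{\tau}\cdots$ is infinite with $p_k\,\mathcal B\,q$ for all $k$, then there is an infinite $q=q_0\xrightarrow{\tau}q_1\xrightarrow{\tau}\cdots$ with $p_k\,\mathcal B\,q_l$ for all $k,l$; and symmetrically. (When one LTS has no infinite $\tau$-sequence from a reachable state, the extra condition amounts to the other having none either.) $N_1\approx^\Delta_{bSTb}N_2$ iff the ST-LTSs of $N_1,N_2$ are branching bisimilar with explicit divergence. -}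

module Defs where

open import Axiom.ExcludedMiddle using (ExcludedMiddle)
open import Data.Bool using (if_then_else_)
open import Data.Fin using (toℕ)
open import Data.Integer as ℤ using (ℤ; +_; 0ℤ; ∣_∣)
open import Data.List using (List; []; _∷_; [_]; _++_; foldr; length; lookup; map; removeAt; sum)
open import Data.List.Membership.Propositional using (_∈_)
open import Data.List.Relation.Unary.Unique.Propositional using (Unique)
import Data.Maybe as Maybe
open import Data.Nat using (ℕ; zero; suc; _+_; _*_; _⊓_; _≤_; _<_)
open import Data.Product using (_×_; _,_; ∃-syntax; Σ-syntax)
open import Data.Product.Relation.Binary.Pointwise.NonDependent using (×-setoid)
open import Data.Sum using (_⊎_; inj₁; inj₂)
open import Data.Unit using (⊤)
open import Function using (flip; _↣_; Injection; Injective)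
open import Level using (0ℓ)
open import Relation.Binary using (REL; Setoid)
open import Relation.Binary.Construct.Add.Supremum.NonStrict _≤_ using (_≤⁺_) public
open import Relation.Binary.Construct.Closure.ReflexiveTransitive using (Star; ε; _◅_)
open import Relation.Binary.Construct.Closure.Transitive using (TransClosure)
open import Relation.Binary.PropositionalEquality
  using (_≡_; _≢_; _≗_; refl; sym; trans; cong; subst; _→-setoid_)
import Relation.Binary.PropositionalEquality as ≡
open import Relation.Nullary using (¬_; yes; no; does)
open import Relation.Nullary.Construct.Add.Supremum using (_⁺; ⊤⁺) renaming ([_] to fin)
open import Relation.Unary using (Pred)

data Action (A : Set) : Set where
  vis : A → Action A
  τ   : Action A

record LTS (A : Set) : Set₁ where
  field
    states  : Setoid 0ℓ 0ℓ
  open Setoid states public using (_≈_) renaming (Carrier to State)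
  field
    start       : State
    _─[_]→_     : State → Action A → State → Set
    ─[]→-resp-≈ : ∀ {p p₁ q q₁ α} → p ≈ p₁ → q ≈ q₁ → p ─[ α ]→ q → p₁ ─[ α ]→ q₁

  _⟹_ : State → State → Set
  _⟹_ = Star (λ p q → p ─[ τ ]→ q)

  _─[⟨_⟩]→_ : State → Action A → State → Set
  p ─[⟨ α ⟩]→ q = p ─[ α ]→ q ⊎ (α ≡ τ × p ≈ q)

module _ {A : Set} (L₁ L₂ : LTS A) where
  private
    module L₁ = LTS L₁
    module L₂ = LTS L₂

  Transfer : REL L₁.State L₂.State 0ℓ → Set
  Transfer B = ∀ {p q α p′} → B p q → p L₁.─[ α ]→ p′ →
    ∃[ q† ] ∃[ q′ ] (q L₂.⟹ q† × q† L₂.─[⟨ α ⟩]→ q′ × B p q† × B p′ q′)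

  DivergenceTransfer : REL L₁.State L₂.State 0ℓ → Set
  DivergenceTransfer B = ∀ {p q} → B p q →
    (ps : ℕ → L₁.State) → ps 0 L₁.≈ p →
    (∀ k → ps k L₁.─[ τ ]→ ps (suc k)) → (∀ k → B (ps k) q) →
    Σ[ qs ∈ (ℕ → L₂.State) ] (qs 0 L₂.≈ q × (∀ l → qs l L₂.─[ τ ]→ qs (suc l)) ×
             (∀ k l → B (ps k) (qs l)))

record IsBranchingBisimulationΔ {A : Set} (L₁ L₂ : LTS A)
    (B : REL (LTS.State L₁) (LTS.State L₂) 0ℓ) : Set where
  private
    module L₁ = LTS L₁
    module L₂ = LTS L₂
  field
    -- B is a relation between states up to their equality.
    resp-≈       : ∀ {p p₁ q q₁} → p L₁.≈ p₁ → q L₂.≈ q₁ → B p q → B p₁ q₁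
    initial      : B L₁.start L₂.start
    transfer     : Transfer L₁ L₂ B
    transfer⁻¹   : Transfer L₂ L₁ (flip B)
    divergence   : DivergenceTransfer L₁ L₂ B
    divergence⁻¹ : DivergenceTransfer L₂ L₁ (flip B)

_≈ᵇΔ_ : {A : Set} → LTS A → LTS A → Set₁
L₁ ≈ᵇΔ L₂ = ∃[ B ] IsBranchingBisimulationΔ L₁ L₂ B

Multiset : Set → Set
Multiset X = X → ℕ

Signed : Set → Set
Signed X = X → ℤ

⌊_⌋ : {X : Set} → Multiset X → Signed X
⌊ A ⌋ x = + A x

infixl 6 _+ᵐ_ _+ˢ_ _-ˢ_
infix  4 _≤ˢ_

_+ᵐ_ : {X : Set} → Multiset X → Multiset X → Multiset X
(A +ᵐ B) x = A x + B x

_+ˢ_ _-ˢ_ : {X : Set} → Signed X → Signed X → Signed X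
(A +ˢ B) x = A x ℤ.+ B x
(A -ˢ B) x = A x ℤ.- B x

_≤ˢ_ : {X : Set} → Signed X → Signed X → Set
A ≤ˢ B = ∀ x → A x ℤ.≤ B x

Disjoint : {X : Set} → Multiset X → Multiset X → Set
Disjoint A B = ∀ x → A x ⊓ B x ≡ 0

record PetriNet (Act : Set) : Set₁ where
  field
    Place Transition : Set
    F  : (Place × Transition) ⊎ (Transition × Place) → ℕ
    M₀ : Multiset Place
    ℓ  : Transition → Action Act

open PetriNet public

data STAction (Act : Set) : Set where
  _begins : Act → STAction Act
  _ends_  : Act → ℕ → STAction Act

module _ {Act : Set} (N : PetriNet Act) where

  Plain : Set
  Plain = Injective _≡_ _≡_ (ℓ N) × (∀ t → ℓ N t ≢ τ)

  preset postset : Transition N → Multiset (Place N)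
  preset  t s = F N (inj₁ (s , t))
  postset t s = F N (inj₂ (t , s))

  effect : Transition N → Signed (Place N)
  effect t = ⌊ postset t ⌋ -ˢ ⌊ preset t ⌋

  Silent : Signed (Transition N) → Set
  Silent G = ∀ t → G t ≢ 0ℤ → ℓ N t ≡ τ

  Node : Set
  Node = Place N ⊎ Transition N

  arc : Node → Node → ℕ
  arc (inj₁ s) (inj₂ t) = F N (inj₁ (s , t))
  arc (inj₂ t) (inj₁ s) = F N (inj₂ (t , s))
  arc _        _        = 0

  InNodes : Pred (Transition N) 0ℓ → Pred Node 0ℓ
  InNodes T⁺ (inj₁ s) = ⊤
  InNodes T⁺ (inj₂ t) = T⁺ t

  -- The transitive closure consists of the paths of length at least 1.
  Acyclic : Pred (Transition N) 0ℓ → Set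
  Acyclic T⁺ = ∀ x → ¬ TransClosure
    (λ y z → InNodes T⁺ y × InNodes T⁺ z × 0 < arc y z) x x

------------------------------------------------------------------------
-- Notions that involve case distinctions on arbitrary propositions:
-- sets have no decidable equality, and suprema and infinite sums need
-- not be computable.

module Classical (em : ExcludedMiddle 0ℓ) where

  maximumUpTo : ℕ → Pred ℕ 0ℓ → ℕ
  maximumUpTo zero    P = 0
  maximumUpTo (suc b) P = if does (em {P (suc b)}) then suc b else maximumUpTo b P

  -- Supremum in ℕ ∪ {∞}; the supremum of the empty set is 0.
  sup : Pred ℕ 0ℓ → ℕ ⁺
  sup P with em {∃[ b ] (∀ n → P n → n ≤ b)}
  ... | yes (b , _) = fin (maximumUpTo b P)
  ... | no  _       = ⊤⁺

  -- Sum of a possibly infinite family of naturals, as the supremum of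
  -- its finite partial sums.
  total : {X : Set} → (X → ℕ) → ℕ ⁺
  total f = sup (λ n → ∃[ xs ] (Unique xs × n ≡ sum (map f xs)))

  Finite : {X : Set} → Signed X → Set
  Finite A = total (λ x → ∣ A x ∣) ≢ ⊤⁺

  -- Sum of a finitely supported family of integers (0 by convention if
  -- the support is not finite); the value does not depend on the
  -- enumeration chosen.
  finsum : {X : Set} → (X → ℤ) → ℤ
  finsum f with em {∃[ xs ] (Unique xs × (∀ x → f x ≢ 0ℤ → x ∈ xs))}
  ... | yes (xs , _) = foldr ℤ._+_ 0ℤ (map f xs)
  ... | no  _        = 0ℤ

  -- Additive extension of h : X → ℤ^Y to finite signed multisets over X.
  extendAdditively : {X Y : Set} → (X → Signed Y) → Signed X → Signed Y
  extendAdditively h G y = finsum (λ x → G x ℤ.* h x y)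

  χ : {X : Set} → Pred X 0ℓ → Multiset X
  χ P x = if does (em {P x}) then 1 else 0

  ⁅_⁆ : {X : Set} → X → Multiset X
  ⁅ x ⁆ = χ (x ≡_)

  -- Extension along the inclusion of a subset, by the default value z.
  extendBy : {A X Y : Set} → A → X ↣ Y → (X → A) → Y → A
  extendBy z ι A y with em {∃[ x ] Injection.to ι x ≡ y}
  ... | yes (x , _) = A x
  ... | no  _       = z

  module _ {Act : Set} (N : PetriNet Act) where

    •Σ : Signed (Transition N) → Signed (Place N)
    •Σ = extendAdditively (λ t → ⌊ preset N t ⌋)

    ⟦_⟧Σ : Signed (Transition N) → Signed (Place N)
    ⟦_⟧Σ = extendAdditively (effect N)

    ℓΣ : Signed (Transition N) → Signed (Action Act)
    ℓΣ = extendAdditively (λ t → ⌊ ⁅ ℓ N t ⁆ ⌋)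

    record Step (M : Multiset (Place N)) (G : Multiset (Transition N))
                (M′ : Multiset (Place N)) : Set where
      field
        nonEmpty : ∃[ t ] G t ≢ 0
        finite   : Finite ⌊ G ⌋
        enabled  : •Σ ⌊ G ⌋ ≤ˢ ⌊ M ⌋
        result   : ⌊ M′ ⌋ ≗ ⌊ M ⌋ +ˢ ⟦ ⌊ G ⌋ ⟧Σ

    Enabled : Multiset (Place N) → Multiset (Transition N) → Set
    Enabled M G = ∃[ M′ ] Step M G M′

    data Reachable : Multiset (Place N) → Set where
      initial : ∀ {M} → M ≗ M₀ N → Reachable M
      step    : ∀ {M G M′} → Reachable M → Step M G M′ → Reachable M′

    ActionStep : Multiset (Place N) → Action Act → Multiset (Place N) → Set
    ActionStep M α M′ = ∃[ t ] (ℓ N t ≡ α × Step M ⁅ t ⁆ M′)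

    ActionEnabled : Multiset (Place N) → Action Act → Set
    ActionEnabled M α = ∃[ M′ ] ActionStep M α M′

    module _ (T⁺ : Pred (Transition N) 0ℓ) (S⁺ : Pred (Place N) 0ℓ) where

      FaithfulPlace : Pred (Place N) 0ℓ
      FaithfulPlace s =
        Maybe.map (λ n → χ S⁺ s + n) (total (λ t → χ T⁺ t * F N (inj₂ (t , s)))) ≡ fin 1

      FaithfulNode : Pred (Node N) 0ℓ
      FaithfulNode (inj₁ s) = FaithfulPlace s
      FaithfulNode (inj₂ t) = T⁺ t

      -- Only the sources of the arcs of a path, hence all its nodes
      -- except possibly the last, are required to be faithful.
      FaithfulPath : Node N → Node N → Set
      FaithfulPath = Star (λ x y → FaithfulNode x × 0 < arc N x y)

      weight : ∀ {x y} → FaithfulPath x y → ℕ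
      weight ε                 = 1
      weight (_◅_ {x} {y} _ π) = arc N x y * weight π

      faithfulOrigins : Node N → Place N → ℕ ⁺
      faithfulOrigins x s =
        sup (λ n → S⁺ s × ∃[ π ] n ≡ weight {inj₁ s} {x} π)

    STMarking : Set
    STMarking = Multiset (Place N) × List (Transition N)

    -- Positions in the list of running transitions are counted from 1.
    STStep : STMarking → Action (STAction Act) → STMarking → Set
    STStep (M , U) (vis (a begins)) (M′ , U′) =
      ∃[ t ] (ℓ N t ≡ vis a × Enabled M ⁅ t ⁆ ×
              ⌊ M′ ⌋ ≗ ⌊ M ⌋ -ˢ ⌊ preset N t ⌋ × U′ ≡ U ++ [ t ])
    STStep (M , U) (vis (a ends n)) (M′ , U′) =
      ∃[ i ] (suc (toℕ i) ≡ n × ℓ N (lookup U i) ≡ vis a ×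
              U′ ≡ removeAt U i × M′ ≗ M +ᵐ postset N (lookup U i))
    STStep (M , U) τ (M′ , U′) = ActionStep M τ M′ × U′ ≡ U

    private
      Step-resp : ∀ {M M₁ G M′ M₁′} → M ≗ M₁ → M′ ≗ M₁′ →
                  Step M G M′ → Step M₁ G M₁′
      Step-resp {G = G} e e′ σ = record
        { nonEmpty = nonEmpty
        ; finite   = finite
        ; enabled  = λ s → subst (λ n → _ ℤ.≤ + n) (e s) (enabled s)
        ; result   = λ s → trans (cong +_ (sym (e′ s)))
                             (trans (result s) (cong (λ n → + n ℤ.+ ⟦ ⌊ G ⌋ ⟧Σ s) (e s)))
        } where open Step σ

      STStep-resp : ∀ {M M₁ U U₁ M′ M₁′ U′ U₁′} α →
        M ≗ M₁ × U ≡ U₁ → M′ ≗ M₁′ × U′ ≡ U₁′ →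
        STStep (M , U) α (M′ , U′) → STStep (M₁ , U₁) α (M₁′ , U₁′)
      STStep-resp (vis (a begins)) (e , refl) (e′ , refl) (t , l , (_ , σ) , m , u) =
        t , l , (_ , Step-resp e (λ _ → refl) σ) ,
        (λ s → trans (cong +_ (sym (e′ s)))
                 (trans (m s) (cong (λ n → + n ℤ.- + preset N t s) (e s)))) , u
      STStep-resp {U = U} (vis (a ends n)) (e , refl) (e′ , refl) (i , p , l , u , m) =
        i , p , l , u ,
        λ s → trans (sym (e′ s)) (trans (m s) (cong (λ n → n + postset N (lookup U i) s) (e s)))
      STStep-resp τ (e , refl) (e′ , refl) ((t , l , σ) , u) =
        (t , l , Step-resp e e′ σ) , u

    ST-LTS : LTS (STAction Act)
    ST-LTS = record
      { states      = ×-setoid (Place N →-setoid ℕ) (≡.setoid (List (Transition N)))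
      ; start       = M₀ N , []
      ; _─[_]→_     = STStep
      ; ─[]→-resp-≈ = λ {_} {_} {_} {_} {α} → STStep-resp α
      }

  infix 4 _≈ᵇˢᵗᵇΔ_

  _≈ᵇˢᵗᵇΔ_ : {Act : Set} → PetriNet Act → PetriNet Act → Set₁
  N₁ ≈ᵇˢᵗᵇΔ N₂ = ST-LTS N₁ ≈ᵇΔ ST-LTS N₂

{-# OPTIONS --safe #-}

-- Call (M , U) and (M′ , U′) related when U and U′ carry the same labels, M + •U and M′ + •U′
-- are reachable, and M + •U = M′ + •U′ + (M₀ − M′₀) + ⟦H⟧ for some finite silent H. A silent
-- step adds a transition to H; starting an action leaves H unchanged; ending an action
-- subtracts from H the G of condition 3.
--
-- For the start of a visible t, take H in normal form, H = H⁺ − H⁻. By (e) and (f), adding ⟦H⁻⟧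
-- to M + •U keeps t enabled, so t is enabled after firing H⁺ ∈ ℕ^{T⁺} from M′ + •U′ + (M₀ − M′₀);
-- hence the faithful origins of t, and with them •t′, lie in M′ + •U′, and (g) excludes •U′.
--
-- Conversely, when M′ enables an action, M either enables it or some silent transition: a minimal
-- transition of H⁻ or, if H⁻ = ∅, of H_{M′,U} − H. The weight f(H) increases along silent steps
-- and is bounded by f(H_{M′,U}), so N cannot postpone the action forever, nor diverge.

module Submission where

open import Defs
open import Axiom.ExcludedMiddle using (ExcludedMiddle)
open import Data.Empty using (⊥-elim)
open import Data.Fin as Fin using (Fin; toℕ)
import Data.Fin.Properties as Fin
open import Data.Integer as ℤ using (ℤ; +_; 0ℤ; ∣_∣)
import Data.Integer.Properties as ℤ
open import Data.Integer.Tactic.RingSolver using (solve-∀)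
open import Data.List
  using (List; []; _∷_; _++_; foldr; map; filter; length; lookup; removeAt; deduplicate)
open import Data.List.Membership.Propositional using (_∈_; _∉_)
open import Data.List.Membership.Propositional.Properties
  using (∈-∃++; ∈-++⁺ˡ; ∈-++⁺ʳ; ∈-++⁻; ∈-filter⁺; ∈-filter⁻; ∈-deduplicate⁺)
open import Data.List.Membership.Propositional.Properties.WithK using (unique∧set⇒bag)
open import Data.List.Relation.Binary.BagAndSetEquality using (∼bag⇒↭)
open import Data.List.Relation.Binary.Permutation.Propositional using (_↭_; prep; swap)
  renaming (refl to ↭-refl; trans to ↭-trans)
open import Data.List.Relation.Binary.Pointwise as Pointwise using (Pointwise; []; _∷_)
open import Data.List.Relation.Unary.All as All using (All; []; _∷_)
open import Data.List.Relation.Unary.All.Properties using (¬Any⇒All¬)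
open import Data.List.Relation.Unary.AllPairs using ([]; _∷_)
open import Data.List.Relation.Unary.Any using (here; there)
open import Data.List.Relation.Unary.Unique.DecPropositional.Properties using (deduplicate-!)
open import Data.List.Relation.Unary.Unique.Propositional using (Unique)
open import Data.List.Relation.Unary.Unique.Propositional.Properties using (filter⁺)
open import Data.Maybe as Maybe using ()
open import Data.Nat as ℕ using (ℕ; zero; suc; _≤_; _<_; z≤n; s≤s)
open import Data.Nat.ListAction using (sum)
import Data.Nat.Properties as ℕ
import Data.Nat.Tactic.RingSolver as ℕSolver
open import Data.Product using (_×_; _,_; ∃-syntax; Σ-syntax; proj₁; proj₂)
open import Data.Sum using (_⊎_; inj₁; inj₂)
open import Data.Unit using (tt)
open import Function using (_↣_; Injection; Injective; _∘_; mk⇔)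
open import Induction.WellFounded using (Acc; acc)
open import Level using (0ℓ)
open import Relation.Binary.Construct.Add.Supremum.NonStrict _≤_ using ([_])
open import Relation.Binary.Construct.Closure.ReflexiveTransitive using (ε; _◅_)
open import Relation.Binary.Construct.Closure.Transitive as Plus using (TransClosure; _∷_)
open import Relation.Binary.PropositionalEquality
  using (_≡_; _≢_; _≗_; refl; sym; trans; cong; cong₂; subst; subst₂; module ≡-Reasoning)
open import Relation.Nullary using (¬_; Dec; yes; no; contradiction)
open import Relation.Nullary.Construct.Add.Supremum using (⊤⁺) renaming ([_] to fin)
open import Relation.Nullary.Decidable using (decidable-stable; ¬?)
open import Relation.Unary using (Pred)

private
  variable
    X Y : Set

-- Finite sums over lists.

Σℤ : {X : Set} → List X → (X → ℤ) → ℤ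
Σℤ xs f = foldr ℤ._+_ 0ℤ (map f xs)

Σℤ-cong : ∀ {f g : X → ℤ} → f ≗ g → ∀ xs → Σℤ xs f ≡ Σℤ xs g
Σℤ-cong e []       = refl
Σℤ-cong e (x ∷ xs) = cong₂ ℤ._+_ (e x) (Σℤ-cong e xs)

Σℤ-+ : ∀ (f g : X → ℤ) xs → Σℤ xs (λ x → f x ℤ.+ g x) ≡ Σℤ xs f ℤ.+ Σℤ xs g
Σℤ-+ f g []       = refl
Σℤ-+ f g (x ∷ xs) = trans (cong (λ n → f x ℤ.+ g x ℤ.+ n) (Σℤ-+ f g xs)) (interchange (f x) (g x) _ _)
  where
  interchange : ∀ a b c d → (a ℤ.+ b) ℤ.+ (c ℤ.+ d) ≡ (a ℤ.+ c) ℤ.+ (b ℤ.+ d)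
  interchange = solve-∀

Σℤ-mono : ∀ {f g : X → ℤ} → (∀ x → f x ℤ.≤ g x) → ∀ xs → Σℤ xs f ℤ.≤ Σℤ xs g
Σℤ-mono le []       = ℤ.≤-refl
Σℤ-mono le (x ∷ xs) = ℤ.+-mono-≤ (le x) (Σℤ-mono le xs)

Σℤ-↭ : ∀ (f : X → ℤ) {xs ys} → xs ↭ ys → Σℤ xs f ≡ Σℤ ys f
Σℤ-↭ f ↭-refl        = refl
Σℤ-↭ f (prep x p)    = cong (λ n → f x ℤ.+ n) (Σℤ-↭ f p)
Σℤ-↭ f (swap x y p)  = trans (cong (λ n → f x ℤ.+ (f y ℤ.+ n)) (Σℤ-↭ f p)) (exchange (f x) (f y) _)
  where
  exchange : ∀ a b c → a ℤ.+ (b ℤ.+ c) ≡ b ℤ.+ (a ℤ.+ c)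
  exchange = solve-∀
Σℤ-↭ f (↭-trans p q) = trans (Σℤ-↭ f p) (Σℤ-↭ f q)

module _ (f : X → ℤ) where

  support : List X → List X
  support = filter (λ x → ¬? (f x ℤ.≟ 0ℤ))

  Σℤ-support : ∀ xs → Σℤ (support xs) f ≡ Σℤ xs f
  Σℤ-support []       = refl
  Σℤ-support (x ∷ xs) with f x ℤ.≟ 0ℤ
  ... | yes fx≡0 = trans (Σℤ-support xs)
                     (trans (sym (ℤ.+-identityˡ _)) (cong (ℤ._+ Σℤ xs f) (sym fx≡0)))
  ... | no  _    = cong (λ n → f x ℤ.+ n) (Σℤ-support xs)

  Enumerates : List X → Set
  Enumerates xs = Unique xs × (∀ x → f x ≢ 0ℤ → x ∈ xs)

  -- The two lists may differ only in order and in entries where `f` vanishes. Once these are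
  -- filtered out, both lists are duplicate-free with the same elements, hence permutations of each
  -- other.
  Σℤ-unique : ∀ {xs ys} → Enumerates xs → Enumerates ys → Σℤ xs f ≡ Σℤ ys f
  Σℤ-unique {xs} {ys} (xs! , cxs) (ys! , cys) = begin
    Σℤ xs f            ≡⟨ Σℤ-support xs ⟨
    Σℤ (support xs) f  ≡⟨ Σℤ-↭ f (∼bag⇒↭ (unique∧set⇒bag (filter⁺ _ xs!) (filter⁺ _ ys!)
                             (mk⇔ (restrict {xs} cys) (restrict {ys} cxs)))) ⟩
    Σℤ (support ys) f  ≡⟨ Σℤ-support ys ⟩
    Σℤ ys f            ∎
    where
    open ≡-Reasoning
    restrict : ∀ {us vs} → (∀ x → f x ≢ 0ℤ → x ∈ vs) → ∀ {x} → x ∈ support us → x ∈ support vs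
    restrict {us} c x∈ with ∈-filter⁻ _ {xs = us} x∈
    ... | _ , fx≢0 = ∈-filter⁺ _ (c _ fx≢0) fx≢0

sum-∈-++ : ∀ (f : X → ℕ) as {x bs} → sum (map f (as ++ x ∷ bs)) ≡ f x ℕ.+ sum (map f (as ++ bs))
sum-∈-++ f []       = refl
sum-∈-++ f (a ∷ as) {x} {bs} =
  trans (cong (f a ℕ.+_) (sum-∈-++ f as)) (exchange (f a) (f x) _)
  where
  exchange : ∀ a b c → a ℕ.+ (b ℕ.+ c) ≡ b ℕ.+ (a ℕ.+ c)
  exchange = ℕSolver.solve-∀

∈-∷-≢ : ∀ {x z : X} as {bs} → x ≢ z → z ∈ as ++ x ∷ bs → z ∈ as ++ bs
∈-∷-≢ as x≢z z∈ with ∈-++⁻ as z∈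
... | inj₁ z∈as         = ∈-++⁺ˡ z∈as
... | inj₂ (here refl)  = contradiction refl x≢z
... | inj₂ (there z∈bs) = ∈-++⁺ʳ as z∈bs

-- Each entry of `ys` with nonzero value is located in `xs` and removed there. As `ys` has no
-- duplicates, the remaining entries are still found in what is left, even if `xs` has repetitions.
sum-≤-cover : ∀ (f : X → ℕ) {xs ys} → Unique ys → (∀ y → f y ≢ 0 → y ∈ ys → y ∈ xs) →
              sum (map f ys) ≤ sum (map f xs)
sum-≤-cover f []          c = z≤n
sum-≤-cover f {xs} {y ∷ ys} (y∉ys ∷ ys!) c with f y ℕ.≟ 0
... | yes fy≡0 = subst (λ n → n ℕ.+ sum (map f ys) ≤ sum (map f xs)) (sym fy≡0)
                   (sum-≤-cover f ys! λ z fz≢0 z∈ys → c z fz≢0 (there z∈ys))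
... | no  fy≢0 with ∈-∃++ (c y fy≢0 (here refl))
... | as , bs , refl = subst (f y ℕ.+ sum (map f ys) ≤_) (sym (sum-∈-++ f as))
        (ℕ.+-monoʳ-≤ (f y) (sum-≤-cover f ys! λ z fz≢0 z∈ys →
          ∈-∷-≢ as (All.lookup y∉ys z∈ys) (c z fz≢0 (there z∈ys))))

length≤sum : ∀ (f : X → ℕ) {xs} → All (λ x → f x ≢ 0) xs → length xs ≤ sum (map f xs)
length≤sum f []         = z≤n
length≤sum f (fx≢0 ∷ a) = ℕ.+-mono-≤ (ℕ.n≢0⇒n>0 fx≢0) (length≤sum f a)

-- Suprema, finite support and additive extension.

module Sums (em : ExcludedMiddle 0ℓ) where
  open Classical em

  maximumUpTo-upper : ∀ b (P : Pred ℕ 0ℓ) {n} → P n → n ≤ b → n ≤ maximumUpTo b P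
  maximumUpTo-upper zero    P Pn n≤b = n≤b
  maximumUpTo-upper (suc b) P Pn n≤b with em {P (suc b)}
  ... | yes _  = n≤b
  ... | no ¬Pb with ℕ.m≤n⇒m<n∨m≡n n≤b
  ...   | inj₁ (s≤s n≤b′) = maximumUpTo-upper b P Pn n≤b′
  ...   | inj₂ refl       = contradiction Pn ¬Pb

  maximumUpTo-least : ∀ b (P : Pred ℕ 0ℓ) {m} → (∀ n → P n → n ≤ m) → maximumUpTo b P ≤ m
  maximumUpTo-least zero    P ub = z≤n
  maximumUpTo-least (suc b) P ub with em {P (suc b)}
  ... | yes Pb = ub _ Pb
  ... | no _   = maximumUpTo-least b P ub

  sup-upper : ∀ (P : Pred ℕ 0ℓ) {m} → sup P ≡ fin m → ∀ n → P n → n ≤ m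
  sup-upper P eq n Pn with em {∃[ b ] (∀ n → P n → n ≤ b)}
  sup-upper P refl n Pn | yes (b , ub) = maximumUpTo-upper b P Pn (ub n Pn)

  -- The bound `m` excludes the value `⊤⁺`, above which every `fin k` would be allowed. The supremum
  -- is then the largest element of `P`, or 0.
  ≤-sup : ∀ (P : Pred ℕ 0ℓ) {k m} → (∀ n → P n → n ≤ m) → fin k ≤⁺ sup P → k ≤ m
  ≤-sup P ub le with em {∃[ b ] (∀ n → P n → n ≤ b)}
  ≤-sup P ub [ le ] | yes (b , _) = ℕ.≤-trans le (maximumUpTo-least b P ub)
  ≤-sup P ub le     | no unbounded = contradiction (_ , ub) unbounded

  total-upper : ∀ (f : X → ℕ) {m} → total f ≡ fin m → ∀ {xs} → Unique xs → sum (map f xs) ≤ m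
  total-upper f eq xs! = sup-upper _ eq _ (_ , xs! , refl)

  FinSupp : (X → ℤ) → Set
  FinSupp f = ∃[ xs ] Enumerates f xs

  total-bounded : ∀ (f : X → ℕ) → total f ≢ ⊤⁺ → ∃[ b ] (∀ {xs} → Unique xs → sum (map f xs) ≤ b)
  total-bounded f tf≢⊤ with em {∃[ b ] (∀ n → ∃[ xs ] (Unique xs × n ≡ sum (map f xs)) → n ≤ b)}
  ... | yes (b , ub) = b , λ xs! → ub _ (_ , xs! , refl)
  ... | no _         = contradiction refl tf≢⊤

  -- Every support element contributes at least 1 to a partial sum, so a duplicate-free list of
  -- support elements has at most `b` entries. Adding missing elements one by one must therefore
  -- stop, and then the list is complete.
  Finite⇒FinSupp : ∀ {G : Signed X} → Finite G → FinSupp G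
  Finite⇒FinSupp {G = G} fin[G] with total-bounded (∣_∣ ∘ G) fin[G]
  ... | b , bound = extend (suc b) [] [] [] (ℕ.≤-reflexive (sym (ℕ.+-identityʳ _)))
    where
    -- `k` is the fuel; the invariant `b < k + length xs` makes running out of it contradict the
    -- bound `b`.
    extend : ∀ k xs → Unique xs → All (λ x → ∣ G x ∣ ≢ 0) xs → b < k ℕ.+ length xs → FinSupp G
    extend zero xs xs! nz b<n =
      contradiction (ℕ.≤-trans b<n (ℕ.≤-trans (length≤sum (∣_∣ ∘ G) nz) (bound xs!))) ℕ.1+n≰n
    extend (suc k) xs xs! nz b<n with em {∃[ x ] (G x ≢ 0ℤ × x ∉ xs)}
    ... | yes (x , Gx≢0 , x∉xs) = extend k (x ∷ xs) (¬Any⇒All¬ xs x∉xs ∷ xs!)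
            ((Gx≢0 ∘ ℤ.∣i∣≡0⇒i≡0) ∷ nz) (subst (b <_) (sym (ℕ.+-suc k _)) b<n)
    ... | no covered = xs , xs! , λ x Gx≢0 → decidable-stable em (λ x∉xs → covered (x , Gx≢0 , x∉xs))

  FinSupp⇒Finite : ∀ {G : Signed X} → FinSupp G → Finite G
  FinSupp⇒Finite {G = G} (xs , _ , c)
    with em {∃[ b ] (∀ n → ∃[ ys ] (Unique ys × n ≡ sum (map (λ x → ∣ G x ∣) ys)) → n ≤ b)}
  ... | yes _ = λ ()
  ... | no unbounded = contradiction
          (_ , λ { _ (ys , ys! , refl) → sum-≤-cover (λ x → ∣ G x ∣) {xs} ys!
                     λ y Gy≢0 _ → c y (λ Gy≡0 → Gy≢0 (cong ∣_∣ Gy≡0)) })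
          unbounded

  finsum-Σℤ : ∀ {f : X → ℤ} {xs} → Enumerates f xs → finsum f ≡ Σℤ xs f
  finsum-Σℤ {f = f} exs with em {∃[ xs ] (Unique xs × (∀ x → f x ≢ 0ℤ → x ∈ xs))}
  ... | yes (_ , eys) = Σℤ-unique f eys exs
  ... | no ¬finite    = contradiction (_ , exs) ¬finite

  FinSupp-⊆ : ∀ {f g : X → ℤ} → (∀ x → f x ≡ 0ℤ → g x ≡ 0ℤ) → FinSupp f → FinSupp g
  FinSupp-⊆ z (xs , xs! , c) = xs , xs! , λ x gx≢0 → c x (gx≢0 ∘ z x)

  FinSupp-≗ : ∀ {f g : X → ℤ} → f ≗ g → FinSupp f → FinSupp g
  FinSupp-≗ e = FinSupp-⊆ (λ x fx≡0 → trans (sym (e x)) fx≡0)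

  -- The support of `h` is covered by the concatenated enumerations; excluded middle serves as the
  -- decidable equality needed to remove duplicates.
  FinSupp-∪ : ∀ {f g h : X → ℤ} → (∀ x → f x ≡ 0ℤ → g x ≡ 0ℤ → h x ≡ 0ℤ) →
              FinSupp f → FinSupp g → FinSupp h
  FinSupp-∪ {f = f} {g} z (xs , _ , cf) (ys , _ , cg) =
    deduplicate _≟_ (xs ++ ys) , deduplicate-! _≟_ _ , λ x hx≢0 → ∈-deduplicate⁺ _≟_ (cover x hx≢0)
    where
    _≟_ : ∀ x y → Dec (x ≡ y)
    _ ≟ _ = em
    cover : ∀ x → _ → x ∈ xs ++ ys
    cover x hx≢0 with f x ℤ.≟ 0ℤ | g x ℤ.≟ 0ℤ
    ... | no fx≢0 | _       = ∈-++⁺ˡ (cf x fx≢0)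
    ... | _       | no gx≢0 = ∈-++⁺ʳ xs (cg x gx≢0)
    ... | yes fx≡0 | yes gx≡0 = contradiction (z x fx≡0 gx≡0) hx≢0

  FinSupp-+ : ∀ {f g : X → ℤ} → FinSupp f → FinSupp g → FinSupp (f +ˢ g)
  FinSupp-+ = FinSupp-∪ (λ _ → cong₂ ℤ._+_)

  FinSupp-- : ∀ {f g : X → ℤ} → FinSupp f → FinSupp g → FinSupp (f -ˢ g)
  FinSupp-- = FinSupp-∪ (λ _ → cong₂ ℤ._-_)

  common-enumeration : ∀ {f g : X → ℤ} → FinSupp f → FinSupp g →
             ∃[ xs ] (Enumerates f xs × Enumerates g xs)
  -- Absolute values prevent cancellation: this sum vanishes only where both `f` and `g` do.
  common-enumeration {f = f} {g} ff fg with FinSupp-∪ {h = λ x → + (∣ f x ∣ ℕ.+ ∣ g x ∣)}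
      (λ x p q → cong₂ (λ a b → + (∣ a ∣ ℕ.+ ∣ b ∣)) p q) ff fg
  ... | xs , xs! , c = xs
      , (xs! , λ x fx≢0 → c x (λ e → fx≢0 (ℤ.∣i∣≡0⇒i≡0 (ℕ.m+n≡0⇒m≡0 _ (ℤ.+-injective e)))))
      , (xs! , λ x gx≢0 → c x (λ e → gx≢0 (ℤ.∣i∣≡0⇒i≡0 (ℕ.m+n≡0⇒n≡0 ∣ f x ∣ (ℤ.+-injective e)))))

  finsum-mono : ∀ {f g : X → ℤ} → FinSupp f → FinSupp g → (∀ x → f x ℤ.≤ g x) →
                finsum f ℤ.≤ finsum g
  finsum-mono ff fg le with common-enumeration ff fg
  ... | xs , ef , eg = subst₂ ℤ._≤_ (sym (finsum-Σℤ ef)) (sym (finsum-Σℤ eg)) (Σℤ-mono le xs)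

  finsum-cong : ∀ {f g : X → ℤ} → FinSupp f → f ≗ g → finsum f ≡ finsum g
  finsum-cong ff@(xs , ef) e with FinSupp-≗ e ff
  ... | ys , eg = ℤ.≤-antisym (finsum-mono ff (ys , eg) (ℤ.≤-reflexive ∘ e))
                              (finsum-mono (ys , eg) ff (ℤ.≤-reflexive ∘ sym ∘ e))

  finsum-+ : ∀ {f g : X → ℤ} → FinSupp f → FinSupp g →
             finsum (λ x → f x ℤ.+ g x) ≡ finsum f ℤ.+ finsum g
  finsum-+ {f = f} {g} ff fg with common-enumeration ff fg
  ... | xs , ef@(xs! , cf) , eg@(_ , cg) = begin
    finsum (λ x → f x ℤ.+ g x)   ≡⟨ finsum-Σℤ (xs! , cover) ⟩
    Σℤ xs (λ x → f x ℤ.+ g x)    ≡⟨ Σℤ-+ f g xs ⟩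
    Σℤ xs f ℤ.+ Σℤ xs g          ≡⟨ cong₂ ℤ._+_ (finsum-Σℤ ef) (finsum-Σℤ eg) ⟨
    finsum f ℤ.+ finsum g        ∎
    where
    open ≡-Reasoning
    cover : ∀ x → f x ℤ.+ g x ≢ 0ℤ → x ∈ xs
    cover x ≢0 with f x ℤ.≟ 0ℤ
    ... | no fx≢0  = cf x fx≢0
    ... | yes fx≡0 = cg x (λ gx≡0 → ≢0 (cong₂ ℤ._+_ fx≡0 gx≡0))

  finsum-single : ∀ {f : X → ℤ} t → (∀ x → x ≢ t → f x ≡ 0ℤ) → finsum f ≡ f t
  finsum-single {f = f} t z = trans (finsum-Σℤ {xs = t ∷ []} (([] ∷ []) , cover)) (ℤ.+-identityʳ _)
    where
    cover : ∀ x → f x ≢ 0ℤ → x ∈ t ∷ []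
    cover x fx≢0 = here (decidable-stable em (λ x≢t → fx≢0 (z x x≢t)))

  -- Compares `f` with `only`, its restriction to the single point `t`, whose sum is `f t`.
  finsum-≥ : ∀ {f : X → ℤ} → FinSupp f → (∀ x → 0ℤ ℤ.≤ f x) → ∀ t → f t ℤ.≤ finsum f
  finsum-≥ {f = f} ff 0≤f t =
    subst (ℤ._≤ finsum f) (trans (finsum-single t away) at)
      (finsum-mono (FinSupp-⊆ vanish ff) ff below)
    where
    only : ∀ x → Dec (x ≡ t) → ℤ
    only x (yes _) = f x
    only x (no _)  = 0ℤ
    away : ∀ x → x ≢ t → only x em ≡ 0ℤ
    away x x≢t with em {x ≡ t}
    ... | yes x≡t = contradiction x≡t x≢t
    ... | no _    = refl
    at : only t em ≡ f t
    at with em {t ≡ t}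
    ... | yes _  = refl
    ... | no t≢t = contradiction refl t≢t
    vanish : ∀ x → f x ≡ 0ℤ → only x em ≡ 0ℤ
    vanish x fx≡0 with em {x ≡ t}
    ... | yes _ = fx≡0
    ... | no _  = refl
    below : ∀ x → only x em ℤ.≤ f x
    below x with em {x ≡ t}
    ... | yes _ = ℤ.≤-refl
    ... | no _  = 0≤f x

  ⁅⁆-at : ∀ (t : X) → ⁅ t ⁆ t ≡ 1
  ⁅⁆-at t with em {t ≡ t}
  ... | yes _  = refl
  ... | no t≢t = contradiction refl t≢t

  ⁅⁆-away : ∀ {t x : X} → t ≢ x → ⁅ t ⁆ x ≡ 0
  ⁅⁆-away {t = t} {x} t≢x with em {t ≡ x}
  ... | yes t≡x = contradiction t≡x t≢x
  ... | no _    = refl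

  FinSupp-⁅⁆ : ∀ (t : X) → FinSupp ⌊ ⁅ t ⁆ ⌋
  FinSupp-⁅⁆ t = t ∷ [] , ([] ∷ []) , λ x ≢0 →
    here (decidable-stable em (λ x≢t → ≢0 (cong +_ (⁅⁆-away (x≢t ∘ sym)))))

  module _ (h : X → Signed Y) where

    FinSupp-* : ∀ {G} → FinSupp G → ∀ y → FinSupp (λ x → G x ℤ.* h x y)
    FinSupp-* fG y = FinSupp-⊆ (λ x Gx≡0 → cong (ℤ._* h x y) Gx≡0) fG

    ext-+ : ∀ {G H} → FinSupp G → FinSupp H →
            extendAdditively h (G +ˢ H) ≗ extendAdditively h G +ˢ extendAdditively h H
    ext-+ {G} {H} fG fH y = trans
      (finsum-cong (FinSupp-* (FinSupp-+ fG fH) y) (λ x → ℤ.*-distribʳ-+ (h x y) (G x) (H x)))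
      (finsum-+ (FinSupp-* fG y) (FinSupp-* fH y))

    ext-cong : ∀ {G H} → FinSupp G → G ≗ H → extendAdditively h G ≗ extendAdditively h H
    ext-cong fG e y = finsum-cong (FinSupp-* fG y) (λ x → cong (ℤ._* h x y) (e x))

    ext-⁅⁆ : ∀ t → extendAdditively h ⌊ ⁅ t ⁆ ⌋ ≗ h t
    ext-⁅⁆ t y = trans (finsum-single t λ x x≢t → cong (λ n → + n ℤ.* h x y) (⁅⁆-away (x≢t ∘ sym)))
                   (trans (cong (λ n → + n ℤ.* h t y) (⁅⁆-at t)) (ℤ.*-identityˡ _))

    ext-0 : ∀ {y} {G} → (∀ x → G x ≢ 0ℤ → h x y ≡ 0ℤ) → extendAdditively h G y ≡ 0ℤ
    ext-0 {y} {G} z = finsum-Σℤ {xs = []} ([] , λ x ≢0 → ⊥-elim (≢0 (vanish x)))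
      where
      vanish : ∀ x → G x ℤ.* h x y ≡ 0ℤ
      vanish x with G x ℤ.≟ 0ℤ
      ... | yes Gx≡0 = cong (ℤ._* h x y) Gx≡0
      ... | no Gx≢0  = trans (cong (G x ℤ.*_) (z x Gx≢0)) (ℤ.*-zeroʳ (G x))

    module _ {y} (0≤h : ∀ x → 0ℤ ℤ.≤ h x y) where

      0≤* : ∀ {G : Signed X} → (∀ x → 0ℤ ℤ.≤ G x) → ∀ x → 0ℤ ℤ.≤ G x ℤ.* h x y
      0≤* {G} 0≤G x = subst (ℤ._≤ G x ℤ.* h x y) (ℤ.*-zeroʳ (G x))
        (ℤ.*-monoˡ-≤-nonNeg (G x) {{ℤ.nonNegative (0≤G x)}} (0≤h x))

      ext-≥ : ∀ {G} → FinSupp G → (∀ x → 0ℤ ℤ.≤ G x) → ∀ t →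
              G t ℤ.* h t y ℤ.≤ extendAdditively h G y
      ext-≥ fG 0≤G = finsum-≥ (FinSupp-* fG y) (0≤* 0≤G)

      ext-nonneg : ∀ {G} → FinSupp G → (∀ x → 0ℤ ℤ.≤ G x) → 0ℤ ℤ.≤ extendAdditively h G y
      ext-nonneg {G} fG 0≤G = subst (ℤ._≤ extendAdditively h G y)
        (ext-0 {y} {λ _ → 0ℤ} (λ _ ≢0 → contradiction refl ≢0))
        (finsum-mono (FinSupp-* (FinSupp-⊆ (λ _ _ → refl) fG) y) (FinSupp-* fG y) (0≤* 0≤G))

a+b≡c⇒a≡c-b : ∀ {a b c} → a ℤ.+ b ≡ c → a ≡ c ℤ.- b
a+b≡c⇒a≡c-b {a} {b} refl = identity a b
  where
  identity : ∀ a b → a ≡ (a ℤ.+ b) ℤ.- b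
  identity = solve-∀

minimal : (R : X → X → Set) → (∀ {x y z} → R x y → R y z → R x z) → (∀ {x} → ¬ R x x) →
          ExcludedMiddle 0ℓ → ∀ x xs → ∃[ m ] (m ∈ x ∷ xs × (∀ w → w ∈ x ∷ xs → ¬ R w m))
minimal R R-trans R-irr em x [] = x , here refl , λ { _ (here refl) → R-irr }
minimal R R-trans R-irr em x (y ∷ ys) with minimal R R-trans R-irr em y ys
... | m , m∈ , min with em {R x m}
...   | yes Rxm = x , here refl , λ
          { _ (here refl)      → R-irr
          ; w (there w∈) Rwx → min w w∈ (R-trans Rwx Rxm) }
...   | no ¬Rxm = m , there m∈ , λ { _ (here refl) → ¬Rxm ; w (there w∈) → min w w∈ }

-- Firing transitions of a Petri net.

module Nets (em : ExcludedMiddle 0ℓ) {Act : Set} (N : PetriNet Act) where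
  open Classical em
  open Sums em

  Σ• : Signed (Transition N) → Signed (Place N)
  Σ• = extendAdditively (λ t → ⌊ postset N t ⌋)

  ⟦⟧-split : ∀ {G} → FinSupp G → ∀ s → ⟦_⟧Σ N G s ≡ Σ• G s ℤ.- •Σ N G s
  ⟦⟧-split {G} fG s = a+b≡c⇒a≡c-b (trans
    (sym (finsum-+ (FinSupp-* (effect N) fG s) (FinSupp-* (λ t → ⌊ preset N t ⌋) fG s)))
    (finsum-cong (FinSupp-+ (FinSupp-* (effect N) fG s) (FinSupp-* (λ t → ⌊ preset N t ⌋) fG s))
      λ t → identity (G t) (+ postset N t s) (+ preset N t s)))
    where
    identity : ∀ g a b → g ℤ.* (a ℤ.- b) ℤ.+ g ℤ.* b ≡ g ℤ.* a
    identity = solve-∀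

  0≤•Σ : ∀ {G} → FinSupp G → (∀ t → 0ℤ ℤ.≤ G t) → ∀ s → 0ℤ ℤ.≤ •Σ N G s
  0≤•Σ fG 0≤G s = ext-nonneg (λ t → ⌊ preset N t ⌋) (λ _ → ℤ.+≤+ z≤n) fG 0≤G

  0≤Σ• : ∀ {G} → FinSupp G → (∀ t → 0ℤ ℤ.≤ G t) → ∀ s → 0ℤ ℤ.≤ Σ• G s
  0≤Σ• fG 0≤G s = ext-nonneg (λ t → ⌊ postset N t ⌋) (λ _ → ℤ.+≤+ z≤n) fG 0≤G

  •Σ-≥ : ∀ {G} → FinSupp G → (∀ t → 0ℤ ℤ.≤ G t) → ∀ t s →
         G t ℤ.* + preset N t s ℤ.≤ •Σ N G s
  •Σ-≥ fG 0≤G t s = ext-≥ (λ t → ⌊ preset N t ⌋) (λ _ → ℤ.+≤+ z≤n) fG 0≤G t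

  module _ {M M′ : Multiset (Place N)} {t : Transition N} where

    step⁅⁆ : (∀ s → preset N t s ≤ M s) →
             (∀ s → + M′ s ≡ + M s ℤ.+ effect N t s) → Step N M ⁅ t ⁆ M′
    step⁅⁆ en res = record
      { nonEmpty = t , λ e → contradiction (trans (sym (⁅⁆-at t)) e) λ ()
      ; finite   = FinSupp⇒Finite (FinSupp-⁅⁆ t)
      ; enabled  = λ s → subst (ℤ._≤ + M s) (sym (ext-⁅⁆ (λ t → ⌊ preset N t ⌋) t s)) (ℤ.+≤+ (en s))
      ; result   = λ s → trans (res s) (cong (λ n → + M s ℤ.+ n) (sym (ext-⁅⁆ (effect N) t s)))
      }

    step⁅⁆-enabled : Step N M ⁅ t ⁆ M′ → ∀ s → preset N t s ≤ M s
    step⁅⁆-enabled σ s = ℤ.drop‿+≤+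
      (subst (ℤ._≤ + M s) (ext-⁅⁆ (λ t → ⌊ preset N t ⌋) t s) (Step.enabled σ s))

    step⁅⁆-result : Step N M ⁅ t ⁆ M′ → ∀ s → + M′ s ≡ + M s ℤ.+ effect N t s
    step⁅⁆-result σ s = trans (Step.result σ s) (cong (λ n → + M s ℤ.+ n) (ext-⁅⁆ (effect N) t s))

  -- The resulting marking is `(M - •G) + G•`, a sum of two nonnegative terms, so taking absolute
  -- values leaves it unchanged and gives a multiset.
  Enabled-≤ : ∀ {M G} → ∃[ t ] G t ≢ 0 → FinSupp ⌊ G ⌋ → •Σ N ⌊ G ⌋ ≤ˢ ⌊ M ⌋ → Enabled N M G
  Enabled-≤ {M} {G} ne fG en = (λ s → ∣ M⁺ s ∣) , record
    { nonEmpty = ne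
    ; finite   = FinSupp⇒Finite fG
    ; enabled  = en
    ; result   = λ s → ℤ.0≤i⇒+∣i∣≡i (0≤M⁺ s)
    }
    where
    M⁺ : Signed (Place N)
    M⁺ = ⌊ M ⌋ +ˢ ⟦_⟧Σ N ⌊ G ⌋
    identity : ∀ a b c → (b ℤ.- a) ℤ.+ c ≡ b ℤ.+ (c ℤ.- a)
    identity = solve-∀
    0≤M⁺ : ∀ s → 0ℤ ℤ.≤ M⁺ s
    0≤M⁺ s = subst (0ℤ ℤ.≤_)
      (trans (identity (•Σ N ⌊ G ⌋ s) (+ M s) (Σ• ⌊ G ⌋ s)) (cong (λ n → + M s ℤ.+ n) (sym (⟦⟧-split fG s))))
      (ℤ.+-mono-≤ (ℤ.i≤j⇒0≤j-i (en s)) (0≤Σ• fG (λ _ → ℤ.+≤+ z≤n) s))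

  Enabled⁅⁆ : ∀ {M t} → (∀ s → preset N t s ≤ M s) → Enabled N M ⁅ t ⁆
  Enabled⁅⁆ {M} {t} en = Enabled-≤ (t , λ e → contradiction (trans (sym (⁅⁆-at t)) e) λ ()) (FinSupp-⁅⁆ t)
    λ s → subst (ℤ._≤ + M s) (sym (ext-⁅⁆ (λ t → ⌊ preset N t ⌋) t s)) (ℤ.+≤+ (en s))

  Enabled-pair : ∀ {M t u} → (∀ s → preset N t s ℕ.+ preset N u s ≤ M s) → Enabled N M (⁅ t ⁆ +ᵐ ⁅ u ⁆)
  Enabled-pair {M} {t} {u} en = Enabled-≤
    (t , λ e → contradiction (trans (sym (⁅⁆-at t)) (ℕ.m+n≡0⇒m≡0 _ e)) λ ())
    (FinSupp-+ (FinSupp-⁅⁆ t) (FinSupp-⁅⁆ u))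
    λ s → subst (ℤ._≤ + M s)
      (sym (trans (ext-+ (λ t → ⌊ preset N t ⌋) (FinSupp-⁅⁆ t) (FinSupp-⁅⁆ u) s)
        (cong₂ ℤ._+_ (ext-⁅⁆ (λ t → ⌊ preset N t ⌋) t s) (ext-⁅⁆ (λ t → ⌊ preset N t ⌋) u s)))) (ℤ.+≤+ (en s))

  Step-≗ : ∀ {M M₁ G M′} → M ≗ M₁ → Step N M G M′ → Step N M₁ G M′
  Step-≗ {G = G} e σ = record
    { nonEmpty = nonEmpty
    ; finite   = finite
    ; enabled  = λ s → subst (λ n → _ ℤ.≤ + n) (e s) (enabled s)
    ; result   = λ s → trans (result s) (cong (λ n → + n ℤ.+ ⟦_⟧Σ N ⌊ G ⌋ s) (e s))
    } where open Step σ

  Reachable-≗ : ∀ {M M₁} → M ≗ M₁ → Reachable N M → Reachable N M₁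
  Reachable-≗ e (initial e₀) = initial (λ s → trans (sym (e s)) (e₀ s))
  Reachable-≗ e (step r σ)   = step r (record
    { nonEmpty = Step.nonEmpty σ
    ; finite   = Step.finite σ
    ; enabled  = Step.enabled σ
    ; result   = λ s → trans (cong +_ (sym (e s))) (Step.result σ s)
    })

  -- By acyclicity, the support of `G` has a member `u` that no other member precedes. No member
  -- then produces into a preplace `s` of `u`, so the effect of `G` at `s` is `- •G`, and `M s`
  -- covers all of `•G`, in particular `•u`. Nonnegativity is demanded only at preplaces of `G`,
  -- which is all that is known when `G` is the negative part of a normal form.
  fireable : ∀ {T* : Pred (Transition N) 0ℓ} {G} (M : Multiset (Place N)) →
    Acyclic N T* → FinSupp G → (∀ t → 0ℤ ℤ.≤ G t) → (∀ t → G t ≢ 0ℤ → T* t) → ∃[ t ] G t ≢ 0ℤ →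
    (∀ t s → G t ≢ 0ℤ → preset N t s ≢ 0 → 0ℤ ℤ.≤ + M s ℤ.+ ⟦_⟧Σ N G s) →
    ∃[ u ] (G u ≢ 0ℤ × (∀ s → preset N u s ≤ M s))
  fireable {T*} {G} M acyclic fG@(xs , _ , c) 0≤G G⊆T* (t , Gt≢0) 0≤M+G =
    u , Gu≢0 , enabled
    where
    _≺_ : Transition N → Transition N → Set
    v ≺ w = TransClosure (λ y z → InNodes N T* y × InNodes N T* z × 0 < arc N y z) (inj₂ v) (inj₂ w)

    nonempty : ∀ {ys} → t ∈ ys → ∃[ y ] ∃[ zs ] ys ≡ y ∷ zs
    nonempty {_ ∷ _} _ = _ , _ , refl

    in-support : ∀ {v} → G v ≢ 0ℤ → v ∈ support G xs
    in-support Gv≢0 = ∈-filter⁺ _ (c _ Gv≢0) Gv≢0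

    least : ∃[ m ] (m ∈ support G xs × (∀ w → w ∈ support G xs → ¬ w ≺ m))
    least with support G xs | nonempty (in-support Gt≢0)
    ... | _ | y , ys , refl = minimal _≺_ Plus._++_ (acyclic _) em y ys

    u = proj₁ least

    Gu≢0 : G u ≢ 0ℤ
    Gu≢0 = proj₂ (∈-filter⁻ _ {xs = xs} (proj₁ (proj₂ least)))

    enabled : ∀ s → preset N u s ≤ M s
    enabled s with preset N u s ℕ.≟ 0
    ... | yes e = subst (_≤ M s) (sym e) z≤n
    ... | no •u≢0 = ℤ.drop‿+≤+ (ℤ.≤-trans (ℤ.≤-trans below (•Σ-≥ fG 0≤G u s))
            (ℤ.0≤i-j⇒j≤i (subst (0ℤ ℤ.≤_) effect≡ (0≤M+G u s Gu≢0 •u≢0))))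
      where
      -- An arc from `w` to `s` would make a path from `w` through `s` to `u`, against the
      -- minimality of `u`.
      no-input : ∀ w → G w ≢ 0ℤ → + postset N w s ≡ 0ℤ
      no-input w Gw≢0 with postset N w s ℕ.≟ 0
      ... | yes e = cong +_ e
      ... | no w•≢0 = contradiction
              (_∷_ {y = inj₁ s} (G⊆T* w Gw≢0 , tt , ℕ.n≢0⇒n>0 w•≢0)
                TransClosure.[ tt , G⊆T* u Gu≢0 , ℕ.n≢0⇒n>0 •u≢0 ])
              (proj₂ (proj₂ least) w (in-support Gw≢0))
      below : + preset N u s ℤ.≤ G u ℤ.* + preset N u s
      below = subst (ℤ._≤ G u ℤ.* + preset N u s) (ℤ.*-identityˡ _)
        (ℤ.*-monoʳ-≤-nonNeg (+ preset N u s) (ℤ.i<j⇒suc[i]≤j (ℤ.≤∧≢⇒< (0≤G u) (Gu≢0 ∘ sym))))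
      identity : ∀ m b → m ℤ.+ (0ℤ ℤ.- b) ≡ m ℤ.- b
      identity = solve-∀
      effect≡ : + M s ℤ.+ ⟦_⟧Σ N G s ≡ + M s ℤ.- •Σ N G s
      effect≡ = trans (cong (λ n → + M s ℤ.+ n) (trans (⟦⟧-split fG s)
                  (cong (λ n → n ℤ.- •Σ N G s) (ext-0 (λ w → ⌊ postset N w ⌋) no-input))))
                  (identity (+ M s) (•Σ N G s))

  -- Faithful places and faithful origins.

  module _ (T⁺ : Pred (Transition N) 0ℓ) (S⁺ : Pred (Place N) 0ℓ) where

    -- An infinite total could not yield `fin 1`, so the total is a number `m` bounding every finite
    -- partial sum. Lists of one and of two transitions are the instances used below.
    faithfulPlace : ∀ {s} → FaithfulPlace N T⁺ S⁺ s →
      ∃[ m ] (χ S⁺ s ℕ.+ m ≡ 1 ×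
        (∀ {xs} → Unique xs → sum (map (λ t → χ T⁺ t ℕ.* postset N t s) xs) ≤ m))
    faithfulPlace {s} p with total (λ t → χ T⁺ t ℕ.* F N (inj₂ (t , s))) in eq
    faithfulPlace {s} p  | Maybe.just m = m , fin-injective p , λ xs! → total-upper _ eq xs!
      where
      fin-injective : ∀ {a b : ℕ} → fin a ≡ fin b → a ≡ b
      fin-injective refl = refl
    faithfulPlace {s} () | Maybe.nothing

    χ-in : ∀ {Z : Set} {P : Pred Z 0ℓ} {x} → P x → χ P x ≡ 1
    χ-in {P = P} {x} Px with em {P x}
    ... | yes _  = refl
    ... | no ¬Px = contradiction Px ¬Px

    weigh : ∀ {t} s → T⁺ t → χ T⁺ t ℕ.* postset N t s ≡ postset N t s
    weigh {t} s t∈T⁺ = trans (cong (ℕ._* postset N t s) (χ-in {P = T⁺} t∈T⁺)) (ℕ.*-identityˡ _)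

    -- Membership in `S⁺` already accounts for the 1 in the definition of faithfulness, leaving 0
    -- for the incoming arcs from `T⁺`.
    faithful-origin : ∀ {s} → FaithfulPlace N T⁺ S⁺ s → S⁺ s → ∀ t → T⁺ t → postset N t s ≡ 0
    faithful-origin {s} p s∈S⁺ t t∈T⁺ with faithfulPlace p
    ... | m , χ+m≡1 , ub = ℕ.n≤0⇒n≡0 (begin
      postset N t s                          ≡⟨ weigh s t∈T⁺ ⟨
      χ T⁺ t ℕ.* postset N t s               ≤⟨ ℕ.m≤m+n _ 0 ⟩
      χ T⁺ t ℕ.* postset N t s ℕ.+ 0         ≤⟨ ub ([] ∷ []) ⟩
      m                                      ≡⟨ ℕ.+-cancelˡ-≡ 1 _ _ (subst (λ n → n ℕ.+ m ≡ 1)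
                                                  (χ-in {P = S⁺} s∈S⁺) χ+m≡1) ⟩
      0                                      ∎)
      where open ℕ.≤-Reasoning

    -- The arc from `t` uses up the whole 1, which leaves nothing for `S⁺`, for a larger weight, or
    -- for another transition of `T⁺`.
    faithful-input : ∀ {s t} → FaithfulPlace N T⁺ S⁺ s → T⁺ t → postset N t s ≢ 0 →
      ¬ S⁺ s × postset N t s ≡ 1 × (∀ u → T⁺ u → u ≢ t → postset N u s ≡ 0)
    faithful-input {s} {t} p t∈T⁺ t•≢0 with faithfulPlace p
    ... | m , χ+m≡1 , ub =
        (λ s∈S⁺ → t•≢0 (faithful-origin p s∈S⁺ t t∈T⁺))
      , ℕ.≤-antisym
          (ℕ.≤-trans (ℕ.≤-reflexive (sym (weigh s t∈T⁺)))
            (ℕ.≤-trans (ℕ.m≤m+n _ 0) (ℕ.≤-trans (ub ([] ∷ [])) m≤1)))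
          (ℕ.n≢0⇒n>0 t•≢0)
      , λ u u∈T⁺ u≢t → ℕ.n≤0⇒n≡0 (ℕ.+-cancelˡ-≤ 1 _ _ (begin
          1 ℕ.+ postset N u s               ≤⟨ ℕ.+-monoˡ-≤ _ (ℕ.n≢0⇒n>0 t•≢0) ⟩
          postset N t s ℕ.+ postset N u s   ≡⟨ cong₂ ℕ._+_ (weigh s t∈T⁺) (weigh s u∈T⁺) ⟨
          χ T⁺ t ℕ.* postset N t s ℕ.+ χ T⁺ u ℕ.* postset N u s
                                            ≤⟨ ℕ.+-monoʳ-≤ (χ T⁺ t ℕ.* postset N t s) (ℕ.m≤m+n _ 0) ⟩
          χ T⁺ t ℕ.* postset N t s ℕ.+ (χ T⁺ u ℕ.* postset N u s ℕ.+ 0)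
                                            ≤⟨ ub (((u≢t ∘ sym) ∷ []) ∷ ([] ∷ [])) ⟩
          m                                 ≤⟨ m≤1 ⟩
          1 ℕ.+ 0                           ∎))
      where
      open ℕ.≤-Reasoning
      m≤1 : m ≤ 1
      m≤1 = ℕ.≤-trans (ℕ.m≤n+m m (χ S⁺ s)) (ℕ.≤-reflexive χ+m≡1)

    module _ {B : Signed (Place N)} {H : Signed (Transition N)} {t : Transition N}
             (B⊆S⁺ : ∀ s → ¬ S⁺ s → B s ≡ 0ℤ) (fH : FinSupp H)
             (0≤H : ∀ v → 0ℤ ℤ.≤ H v) (H⊆T⁺ : ∀ v → H v ≢ 0ℤ → T⁺ v)
             (t-enabled : ∀ s → + preset N t s ℤ.≤ B s ℤ.+ ⟦_⟧Σ N H s)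
             where

      -- A balance of tokens: all that `H` and one further firing of `t` consume is covered by `B`
      -- and the production of `H`. The order of the firings is immaterial.
      t-•H : ∀ s → + preset N t s ℤ.+ •Σ N H s ℤ.≤ B s ℤ.+ Σ• H s
      t-•H s = ℤ.0≤i-j⇒j≤i (subst (0ℤ ℤ.≤_) (trans
          (cong (λ n → B s ℤ.+ n ℤ.- + preset N t s) (⟦⟧-split fH s))
          (identity (B s) (Σ• H s) (•Σ N H s) (+ preset N t s)))
        (ℤ.i≤j⇒0≤j-i (t-enabled s)))
        where
        identity : ∀ b p q r → b ℤ.+ (p ℤ.- q) ℤ.- r ≡ b ℤ.+ p ℤ.- (r ℤ.+ q)
        identity = solve-∀

      -- A faithful place outside S⁺ obtains its tokens from a single transition, one at a
      -- time, so any demand on the place is a demand on the number of firings of that transition.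
      tokens⇒firings : ∀ {v w k} → FaithfulPlace N T⁺ S⁺ w → T⁺ v → 0 < postset N v w →
                       + k ℤ.≤ B w ℤ.+ Σ• H w → + (postset N v w ℕ.* k) ℤ.≤ H v
      tokens⇒firings {v} {w} {k} w-faithful v∈T⁺ 0<v• k≤
        with faithful-input w-faithful v∈T⁺ (ℕ.n>0⇒n≢0 0<v•)
      ... | w∉S⁺ , v•≡1 , others = begin
        + (postset N v w ℕ.* k)
          ≡⟨ cong +_ (trans (cong (ℕ._* k) v•≡1) (ℕ.*-identityˡ _)) ⟩
        + k
          ≤⟨ k≤ ⟩
        B w ℤ.+ Σ• H w
          ≡⟨ cong₂ ℤ._+_ (B⊆S⁺ w w∉S⁺) (finsum-single v only-v) ⟩
        0ℤ ℤ.+ H v ℤ.* + postset N v w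
          ≡⟨ trans (ℤ.+-identityˡ _) (trans (cong (λ n → H v ℤ.* + n) v•≡1) (ℤ.*-identityʳ _)) ⟩
        H v
          ∎
        where
        open ℤ.≤-Reasoning
        only-v : ∀ u → u ≢ v → H u ℤ.* + postset N u w ≡ 0ℤ
        only-v u u≢v with H u ℤ.≟ 0ℤ
        ... | yes Hu≡0 = cong (ℤ._* + postset N u w) Hu≡0
        ... | no Hu≢0  = trans (cong (λ n → H u ℤ.* + n) (others u (H⊆T⁺ u Hu≢0) u≢v)) (ℤ.*-zeroʳ (H u))

      -- Induction along the path, two arcs at a time. The demand at the next place `w` forces that
      -- many firings of the transition `v` before it, and each of these consumes `preset N v s`
      -- tokens from `s`; the last arc is the demand of `t` itself. Arcs between two places or two
      -- transitions have weight 0, which rules out the other shapes.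
      weight≤tokens : ∀ {s} (π : FaithfulPath N T⁺ S⁺ (inj₁ s) (inj₂ t)) →
                      + weight N T⁺ S⁺ π ℤ.≤ B s ℤ.+ Σ• H s
      weight≤tokens {s} (_◅_ {j = inj₁ _} (_ , ()) π)
      weight≤tokens {s} (_◅_ {j = inj₂ .t} (_ , _) ε) = begin
        + (preset N t s ℕ.* 1)          ≡⟨ cong +_ (ℕ.*-identityʳ _) ⟩
        + preset N t s                  ≡⟨ ℤ.+-identityʳ _ ⟨
        + preset N t s ℤ.+ 0ℤ           ≤⟨ ℤ.+-monoʳ-≤ (+ preset N t s) (0≤•Σ fH 0≤H s) ⟩
        + preset N t s ℤ.+ •Σ N H s     ≤⟨ t-•H s ⟩
        B s ℤ.+ Σ• H s                  ∎
        where open ℤ.≤-Reasoning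
      weight≤tokens {s} (_◅_ {j = inj₂ v} _ (_◅_ {j = inj₂ _} (_ , ()) _))
      weight≤tokens {s} (_◅_ {j = inj₂ v} _ (_◅_ {j = inj₁ w} _ (_◅_ {j = inj₁ _} (_ , ()) _)))
      weight≤tokens {s} (_◅_ {j = inj₂ v} _ (_◅_ {j = inj₁ w} (v∈T⁺ , 0<v•)
        π@(_◅_ {j = inj₂ _} (w-faithful , _) _))) = begin
        + (preset N v s ℕ.* (postset N v w ℕ.* weight N T⁺ S⁺ π))
          ≡⟨ ℤ.pos-* (preset N v s) _ ⟩
        + preset N v s ℤ.* + (postset N v w ℕ.* weight N T⁺ S⁺ π)
          ≤⟨ ℤ.*-monoˡ-≤-nonNeg (+ preset N v s) (tokens⇒firings w-faithful v∈T⁺ 0<v• (weight≤tokens π)) ⟩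
        + preset N v s ℤ.* H v
          ≡⟨ ℤ.*-comm (+ preset N v s) (H v) ⟩
        H v ℤ.* + preset N v s
          ≤⟨ •Σ-≥ fH 0≤H v s ⟩
        •Σ N H s
          ≤⟨ ℤ.i≤j+i (•Σ N H s) (+ preset N t s) ⟩
        + preset N t s ℤ.+ •Σ N H s
          ≤⟨ t-•H s ⟩
        B s ℤ.+ Σ• H s
          ∎
        where open ℤ.≤-Reasoning

      -- A faithful place in `S⁺` receives nothing from `T⁺`, so the production of `H` there is 0
      -- and the bound on path weights reduces to `B s`. This bounds the supremum defining the
      -- faithful origins.
      faithful-tokens : ∀ {s k} → 0ℤ ℤ.≤ B s → fin k ≤⁺ faithfulOrigins N T⁺ S⁺ (inj₂ t) s → + k ℤ.≤ B s
      faithful-tokens {s} {k} 0≤Bs le = subst (+ k ℤ.≤_) (ℤ.0≤i⇒+∣i∣≡i 0≤Bs)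
        (ℤ.+≤+ (≤-sup _ (λ { _ (s∈S⁺ , π , refl) → ℤ.drop‿+≤+
          (subst (+ weight N T⁺ S⁺ π ℤ.≤_) (sym (ℤ.0≤i⇒+∣i∣≡i 0≤Bs)) (bounded s∈S⁺ π)) }) le))
        where
        bounded : S⁺ s → (π : FaithfulPath N T⁺ S⁺ (inj₁ s) (inj₂ t)) → + weight N T⁺ S⁺ π ℤ.≤ B s
        bounded s∈S⁺ (_◅_ {j = inj₁ _} (_ , ()) _)
        bounded s∈S⁺ π@(_◅_ {j = inj₂ _} (s-faithful , _) _) = subst (+ weight N T⁺ S⁺ π ℤ.≤_)
          (trans (cong (λ n → B s ℤ.+ n) (ext-0 (λ v → ⌊ postset N v ⌋)
            λ v Hv≢0 → cong +_ (faithful-origin s-faithful s∈S⁺ v (H⊆T⁺ v Hv≢0)))) (ℤ.+-identityʳ (B s)))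
          (weight≤tokens π)

-- Lists of running transitions.

sum-map-++-[] : ∀ (g : X → ℕ) xs x → sum (map g (xs ++ x ∷ [])) ≡ sum (map g xs) ℕ.+ g x
sum-map-++-[] g []       x = ℕ.+-identityʳ (g x)
sum-map-++-[] g (y ∷ xs) x = trans (cong (g y ℕ.+_) (sum-map-++-[] g xs x)) (sym (ℕ.+-assoc (g y) _ _))

sum-map-removeAt : ∀ (g : X → ℕ) xs i →
  sum (map g xs) ≡ g (lookup xs i) ℕ.+ sum (map g (removeAt xs i))
sum-map-removeAt g (x ∷ xs) Fin.zero    = refl
sum-map-removeAt g (x ∷ xs) (Fin.suc i) =
  trans (cong (g x ℕ.+_) (sum-map-removeAt g xs i)) (exchange (g x) (g (lookup xs i)) _)
  where
  exchange : ∀ a b c → a ℕ.+ (b ℕ.+ c) ≡ b ℕ.+ (a ℕ.+ c)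
  exchange = ℕSolver.solve-∀

sum-map-0 : ∀ (g : X → ℕ) xs → (∀ x → x ∈ xs → g x ≡ 0) → sum (map g xs) ≡ 0
sum-map-0 g []       z = refl
sum-map-0 g (x ∷ xs) z = cong₂ ℕ._+_ (z x (here refl)) (sum-map-0 g xs (λ y → z y ∘ there))

∈⇒≤sum : ∀ (g : X → ℕ) {xs x} → x ∈ xs → g x ≤ sum (map g xs)
∈⇒≤sum g (here refl)        = ℕ.m≤m+n _ _
∈⇒≤sum g {y ∷ xs} (there p) = ℕ.≤-trans (∈⇒≤sum g p) (ℕ.m≤n+m _ (g y))

Σℤ-pos : ∀ (g : X → ℕ) xs → Σℤ xs (λ x → + g x) ≡ + sum (map g xs)
Σℤ-pos g []       = refl
Σℤ-pos g (x ∷ xs) = cong (λ n → + g x ℤ.+ n) (Σℤ-pos g xs)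

module _ {R : X → Y → Set} where

  Pointwise-removeAt : ∀ {xs ys} → Pointwise R xs ys → ∀ i → ∃[ j ]
    (toℕ i ≡ toℕ j × R (lookup xs i) (lookup ys j) × Pointwise R (removeAt xs i) (removeAt ys j))
  Pointwise-removeAt (r ∷ rs) Fin.zero    = Fin.zero , refl , r , rs
  Pointwise-removeAt (r ∷ rs) (Fin.suc i) with Pointwise-removeAt rs i
  ... | j , i≡j , r′ , rs′ = Fin.suc j , cong suc i≡j , r′ , r ∷ rs′

  Pointwise-∈ʳ : ∀ {xs ys y} → Pointwise R xs ys → y ∈ ys → ∃[ x ] (x ∈ xs × R x y)
  Pointwise-∈ʳ (r ∷ rs) (here refl) = _ , here refl , r
  Pointwise-∈ʳ (r ∷ rs) (there y∈) with Pointwise-∈ʳ rs y∈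
  ... | x , x∈ , Rxy = x , there x∈ , Rxy

  Pointwise-∈ˡ : ∀ {xs ys x} → Pointwise R xs ys → x ∈ xs → ∃[ y ] R x y
  Pointwise-∈ˡ (r ∷ rs) (here refl) = _ , r
  Pointwise-∈ˡ (r ∷ rs) (there x∈)  = Pointwise-∈ˡ rs x∈

module _ {A : Set} (N : PetriNet A) where

  presets : List (Transition N) → Multiset (Place N)
  presets U s = sum (map (λ t → preset N t s) U)

-- Positive and negative parts; disjoint multisets.

positivePart negativePart : Signed X → Multiset X
positivePart H x with H x
... | + n         = n
... | ℤ.-[1+ n ]  = 0
negativePart H x with H x
... | + n         = 0
... | ℤ.-[1+ n ]  = suc n

module _ (H : Signed X) where

  positivePart≢0 : ∀ x → positivePart H x ≢ 0 → 0ℤ ℤ.< H x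
  positivePart≢0 x ≢0 with H x
  ... | + n = ℤ.+<+ (ℕ.n≢0⇒n>0 ≢0)
  ... | ℤ.-[1+ n ] = contradiction refl ≢0

  negativePart≢0 : ∀ x → negativePart H x ≢ 0 → H x ℤ.< 0ℤ
  negativePart≢0 x ≢0 with H x
  ... | + n = contradiction refl ≢0
  ... | ℤ.-[1+ n ] = ℤ.-<+

  <0⇒negativePart≢0 : ∀ x → H x ℤ.< 0ℤ → negativePart H x ≢ 0
  <0⇒negativePart≢0 x Hx<0 e with H x
  <0⇒negativePart≢0 x (ℤ.+<+ ()) e  | + n
  <0⇒negativePart≢0 x Hx<0       () | ℤ.-[1+ n ]

  positive-negative : ∀ x → + positivePart H x ≡ H x ℤ.+ + negativePart H x
  positive-negative x with H x
  ... | + n        = sym (ℤ.+-identityʳ _)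
  ... | ℤ.-[1+ n ] = sym (ℤ.n⊖n≡0 (suc n))

Disjoint⇒≡0 : ∀ {A B : Multiset X} → Disjoint A B → ∀ {x} → A x ≢ 0 → B x ≡ 0
Disjoint⇒≡0 {A = A} {B} d {x} Ax≢0 with A x | B x | d x
... | zero  | _     | _  = contradiction refl Ax≢0
... | suc _ | zero  | _  = refl
... | suc _ | suc _ | ()

pos-∸ : ∀ {m n} → n ≤ m → + (m ℕ.∸ n) ≡ + m ℤ.- + n
pos-∸ {m} {n} n≤m = trans (sym (ℤ.⊖-≥ n≤m)) (sym (ℤ.m-n≡m⊖n m n))

-- Extension along the inclusion of places.

module Embedding (em : ExcludedMiddle 0ℓ) {S S′ : Set} (ι : S′ ↣ S) where
  open Classical em
  open Injection ι using (to; injective)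

  module _ {A : Set} (z : A) where

    extendBy-∈ : ∀ B s → extendBy z ι B (to s) ≡ B s
    extendBy-∈ B s with em {∃[ s′ ] to s′ ≡ to s}
    ... | yes (s′ , e) = cong B (injective e)
    ... | no s∉        = contradiction (s , refl) s∉

    extendBy-∉ : ∀ B {s} → ¬ (∃[ s′ ] to s′ ≡ s) → extendBy z ι B s ≡ z
    extendBy-∉ B {s} s∉ with em {∃[ s′ ] to s′ ≡ s}
    ... | yes s∈ = contradiction s∈ s∉
    ... | no _   = refl

    extendBy-cong : ∀ {B C} → B ≗ C → extendBy z ι B ≗ extendBy z ι C
    extendBy-cong e s with em {∃[ s′ ] to s′ ≡ s}
    ... | yes (s′ , _) = e s′
    ... | no _         = refl

  extendBy-+ : ∀ B C → extendBy 0ℤ ι (B +ˢ C) ≗ extendBy 0ℤ ι B +ˢ extendBy 0ℤ ι C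
  extendBy-+ B C s with em {∃[ s′ ] to s′ ≡ s}
  ... | yes _ = refl
  ... | no _  = refl

-- Lists as finite multisets.

module Counting (em : ExcludedMiddle 0ℓ) where
  open Classical em
  open Sums em

  count : List X → Multiset X
  count xs y = sum (map (λ x → ⁅ x ⁆ y) xs)

  FinSupp-count : ∀ (xs : List X) → FinSupp ⌊ count xs ⌋
  FinSupp-count []       = [] , [] , λ _ ≢0 → contradiction refl ≢0
  FinSupp-count (x ∷ xs) = FinSupp-+ (FinSupp-⁅⁆ x) (FinSupp-count xs)

  ext-count : ∀ (h : X → Signed Y) xs y →
              extendAdditively h ⌊ count xs ⌋ y ≡ Σℤ xs (λ x → h x y)
  ext-count h []       y = ext-0 h {y} {λ _ → 0ℤ} (λ _ ≢0 → contradiction refl ≢0)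
  ext-count h (x ∷ xs) y = trans (ext-+ h (FinSupp-⁅⁆ x) (FinSupp-count xs) y)
                             (cong₂ ℤ._+_ (ext-⁅⁆ h x y) (ext-count h xs y))

  module _ {A : Set} (N : PetriNet A) where

    •Σ-count : ∀ U s → •Σ N ⌊ count U ⌋ s ≡ + presets N U s
    •Σ-count U s = trans (ext-count (λ t → ⌊ preset N t ⌋) U s) (Σℤ-pos (λ t → preset N t s) U)

  FinSupp-positivePart : ∀ {H : Signed X} → FinSupp H → FinSupp ⌊ positivePart H ⌋
  FinSupp-positivePart {H = H} = FinSupp-⊆ vanish
    where
    vanish : ∀ x → H x ≡ 0ℤ → + positivePart H x ≡ 0ℤ
    vanish x e with H x
    vanish x refl | _ = refl

  FinSupp-negativePart : ∀ {H : Signed X} → FinSupp H → FinSupp ⌊ negativePart H ⌋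
  FinSupp-negativePart {H = H} = FinSupp-⊆ vanish
    where
    vanish : ∀ x → H x ≡ 0ℤ → + negativePart H x ≡ 0ℤ
    vanish x e with H x
    vanish x refl | _ = refl

-- Determinism under an injective labelling.

module Deterministic (em : ExcludedMiddle 0ℓ) {Act : Set} {N : PetriNet Act}
                     (ℓ-injective : Injective _≡_ _≡_ (ℓ N)) where
  open Classical em

  -- For a beginning, the label determines the transition; for an ending, the position does.
  STStep-deterministic : ∀ {q η q₁ q₂} → STStep N q (vis η) q₁ → STStep N q (vis η) q₂ →
                         LTS._≈_ (ST-LTS N) q₁ q₂
  STStep-deterministic {η = a begins} (t , ℓt , _ , m , u) (t₁ , ℓt₁ , _ , m₁ , u₁)
    with ℓ-injective (trans ℓt (sym ℓt₁))
  ... | refl = (λ s → ℤ.+-injective (trans (m s) (sym (m₁ s)))) , trans u (sym u₁)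
  STStep-deterministic {η = a ends n} (i , i≡n , _ , u , m) (i₁ , i₁≡n , _ , u₁ , m₁)
    with Fin.toℕ-injective (ℕ.suc-injective (trans i≡n (sym i₁≡n)))
  ... | refl = (λ s → trans (m s) (sym (m₁ s))) , trans u (sym u₁)

theorem3 :
  (em : ExcludedMiddle 0ℓ) → let open Classical em in
  {Act : Set} (N N′ : PetriNet Act) → Plain N′ →
  -- S′ ⊆ S and M′₀ = M₀ ↾ S′
  (ι : Place N′ ↣ Place N) →
  (∀ s → M₀ N′ s ≡ M₀ N (Injection.to ι s)) →
  (T⁺ T⁻ : Pred (Transition N) 0ℓ) (NF : Pred (Signed (Transition N)) 0ℓ) →
  -- 1
  Acyclic N T⁺ →
  -- 2
  Acyclic N T⁻ →
  -- 3
  (let S⁺ = λ s → (∃[ s′ ] Injection.to ι s′ ≡ s) ⊎ 0 < M₀ N s in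
   ∀ t → ℓ N t ≢ τ →
   ∃[ t′ ] (ℓ N′ t′ ≡ ℓ N t
     × (∀ s → fin (extendBy 0 ι (preset N′ t′) s) ≤⁺ faithfulOrigins N T⁺ S⁺ (inj₂ t) s)
     × (Σ[ G ∈ Multiset (Transition N) ] (Finite ⌊ G ⌋ × Silent N ⌊ G ⌋
         × extendBy 0ℤ ι (effect N′ t′) ≗ ⟦_⟧Σ N ⌊ ⁅ t ⁆ +ᵐ G ⌋)))) →
  -- 4
  (Σ[ f ∈ (Transition N → ℕ) ] ((∀ t → 0 < f t) ×
    (let fΣ = λ (G : Signed (Transition N)) → finsum (λ t → G t ℤ.* + f t) in
     ∀ G → Finite G → Silent N G →
     Σ[ H ∈ Signed (Transition N) ] (Finite H × NF H × Silent N H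
       × ⟦_⟧Σ N H ≗ ⟦_⟧Σ N G × fΣ H ≡ fΣ G)))) →
  -- 5
  ((M′ : Multiset (Place N′)) (U′ : Multiset (Transition N′)) (U : Multiset (Transition N)) →
   Finite ⌊ U′ ⌋ → Finite ⌊ U ⌋ → ℓΣ N ⌊ U ⌋ ≗ ℓΣ N′ ⌊ U′ ⌋ →
   (K′ : Multiset (Place N′)) → ⌊ K′ ⌋ ≗ ⌊ M′ ⌋ +ˢ •Σ N′ ⌊ U′ ⌋ → Reachable N′ K′ →
   let marking = λ (H : Signed (Transition N)) →
         extendBy 0ℤ ι (⌊ M′ ⌋ +ˢ •Σ N′ ⌊ U′ ⌋)
         +ˢ (⌊ M₀ N ⌋ -ˢ extendBy 0ℤ ι ⌊ M₀ N′ ⌋)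
         +ˢ ⟦_⟧Σ N H -ˢ •Σ N ⌊ U ⌋ in
   Σ[ Hᵐ ∈ Multiset (Transition N) ] (Finite ⌊ Hᵐ ⌋ × (∀ t → Hᵐ t ≢ 0 → T⁺ t) × Silent N ⌊ Hᵐ ⌋ ×
     ((H : Signed (Transition N)) → Finite H → NF H →
      (M : Multiset (Place N)) → ⌊ M ⌋ ≗ marking H →
      (K : Multiset (Place N)) → ⌊ K ⌋ ≗ ⌊ M ⌋ +ˢ •Σ N ⌊ U ⌋ → Reachable N K →
      -- a, b
      (Σ[ Mᵐ ∈ Multiset (Place N) ] (⌊ Mᵐ ⌋ ≗ marking ⌊ Hᵐ ⌋
        × (∀ a → ActionEnabled N′ M′ (vis a) → ActionEnabled N Mᵐ (vis a))))
      -- c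
      × H ≤ˢ ⌊ Hᵐ ⌋
      -- d
      × (∀ u → H u ℤ.< 0ℤ → T⁻ u)
      -- e
      × (∀ u t → H u ℤ.< 0ℤ → 0ℤ ℤ.< H t → Disjoint (preset N u) (preset N t))
      -- f
      × (∀ u t → H u ℤ.< 0ℤ → Enabled N K ⁅ t ⁆ → ℓ N t ≢ τ →
           Disjoint (preset N u) (preset N t))
      -- g
      × (∀ t u t′ u′ → Enabled N K (⁅ t ⁆ +ᵐ ⁅ u ⁆) →
           ℓ N′ t′ ≡ ℓ N t → ℓ N′ u′ ≡ ℓ N u →
           Disjoint (preset N′ t′) (preset N′ u′))))) →
  N ≈ᵇˢᵗᵇΔ N′
theorem3 em {Act} N N′ (ℓ′-injective , ℓ′-visible) ι M₀-agrees T⁺ T⁻ NF acyclic⁺ acyclic⁻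
         origins (f , 0<f , normalise) bounds = B , record
  { resp-≈       = B-resp
  ; initial      = (λ _ → 0ℤ) , record
      { labels  = []
      ; reach   = initial (λ s → ℕ.+-identityʳ _)
      ; reach′  = initial (λ s → ℕ.+-identityʳ _)
      ; finite  = [] , [] , λ _ ≢0 → contradiction refl ≢0
      ; silent  = λ _ ≢0 → contradiction refl ≢0
      ; marking = initial-marking
      }
  ; transfer     = transfer
  ; transfer⁻¹   = transfer⁻¹
  -- Both divergence clauses hold vacuously: silent steps of `N` terminate from every related state,
  -- and `N′` has no silent steps.
  ; divergence   = λ _ ps _ chain B[ps] →
      contradiction chain (no-chain (terminating (B[ps] 0)) ps refl)
  ; divergence⁻¹ = λ _ qs _ chain _ → contradiction (proj₁ (chain 0)) ¬τ′
  }
  where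
  open Classical em
  open Sums em
  open Counting em
  open Embedding em ι
  open Nets em N
  open Injection ι using (to)
  module 𝒩′ = Nets em N′

  -- Markings of `N` built from markings of `N′`.

  S⁺ : Pred (Place N) 0ℓ
  S⁺ s = (∃[ s′ ] to s′ ≡ s) ⊎ 0 < M₀ N s

  E : Signed (Place N′) → Signed (Place N)
  E = extendBy 0ℤ ι

  -- The marking `K′ + (M₀ - M₀′)`. It is `K′` on the places of `N′` and `M₀` elsewhere, because the
  -- two initial markings agree on the former; hence it is nonnegative and vanishes outside `S⁺`.
  base : Multiset (Place N′) → Signed (Place N)
  base K′ s = E ⌊ K′ ⌋ s ℤ.+ (+ M₀ N s ℤ.- E ⌊ M₀ N′ ⌋ s)

  base-cong : ∀ {K′ K′₁} → K′ ≗ K′₁ → base K′ ≗ base K′₁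
  base-cong e s = cong (ℤ._+ _) (extendBy-cong 0ℤ (cong +_ ∘ e) s)

  base-∈ : ∀ K′ s′ → base K′ (to s′) ≡ + K′ s′
  base-∈ K′ s′ = trans
    (cong₂ (λ k m → k ℤ.+ (+ M₀ N (to s′) ℤ.- m)) (extendBy-∈ 0ℤ ⌊ K′ ⌋ s′)
      (trans (extendBy-∈ 0ℤ ⌊ M₀ N′ ⌋ s′) (cong +_ (M₀-agrees s′))))
    (identity (+ K′ s′) (+ M₀ N (to s′)))
    where
    identity : ∀ k m → k ℤ.+ (m ℤ.- m) ≡ k
    identity = solve-∀

  base-∉ : ∀ K′ {s} → ¬ (∃[ s′ ] to s′ ≡ s) → base K′ s ≡ + M₀ N s
  base-∉ K′ {s} s∉ = trans
    (cong₂ (λ k m → k ℤ.+ (+ M₀ N s ℤ.- m)) (extendBy-∉ 0ℤ ⌊ K′ ⌋ s∉) (extendBy-∉ 0ℤ ⌊ M₀ N′ ⌋ s∉))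
    (identity (+ M₀ N s))
    where
    identity : ∀ m → 0ℤ ℤ.+ (m ℤ.- 0ℤ) ≡ m
    identity = solve-∀

  0≤base : ∀ K′ s → 0ℤ ℤ.≤ base K′ s
  0≤base K′ s = cases em
    where
    cases : Dec (∃[ s′ ] to s′ ≡ s) → 0ℤ ℤ.≤ base K′ s
    cases (yes (s′ , refl)) = subst (0ℤ ℤ.≤_) (sym (base-∈ K′ s′)) (ℤ.+≤+ z≤n)
    cases (no s∉)           = subst (0ℤ ℤ.≤_) (sym (base-∉ K′ s∉)) (ℤ.+≤+ z≤n)

  base⊆S⁺ : ∀ K′ s → ¬ S⁺ s → base K′ s ≡ 0ℤ
  base⊆S⁺ K′ s s∉S⁺ = trans (base-∉ K′ (s∉S⁺ ∘ inj₁))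
    (cong +_ (ℕ.n≤0⇒n≡0 (ℕ.≮⇒≥ (s∉S⁺ ∘ inj₂))))

  initial-marking : ∀ s → + (M₀ N s ℕ.+ 0) ≡ base (M₀ N′ +ᵐ presets N′ []) s ℤ.+ ⟦_⟧Σ N (λ _ → 0ℤ) s
  initial-marking s = begin
    + (M₀ N s ℕ.+ 0)              ≡⟨ cong +_ (ℕ.+-identityʳ _) ⟩
    + M₀ N s                      ≡⟨ identity (E ⌊ M₀ N′ ⌋ s) (+ M₀ N s) ⟩
    base (M₀ N′) s ℤ.+ 0ℤ         ≡⟨ cong₂ ℤ._+_ (base-cong (sym ∘ λ s′ → ℕ.+-identityʳ (M₀ N′ s′)) s)
                                       (sym (ext-0 (effect N) {s} {λ _ → 0ℤ} (λ _ ≢0 → contradiction refl ≢0))) ⟩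
    base (M₀ N′ +ᵐ presets N′ []) s ℤ.+ ⟦_⟧Σ N (λ _ → 0ℤ) s  ∎
    where
    open ≡-Reasoning
    identity : ∀ e m → m ≡ e ℤ.+ (m ℤ.- e) ℤ.+ 0ℤ
    identity = solve-∀

  -- The relation between ST-markings.

  SameLabel : Transition N → Transition N′ → Set
  SameLabel t t′ = ℓ N t ≡ ℓ N′ t′

  -- `H` is a parameter, since its weight is measured along silent steps and since it may be
  -- exchanged for a normal form while both ST-markings stay fixed.
  record Linked (H : Signed (Transition N)) (M : Multiset (Place N)) (U : List (Transition N))
                (M′ : Multiset (Place N′)) (U′ : List (Transition N′)) : Set where
    field
      labels  : Pointwise SameLabel U U′
      reach   : Reachable N (M +ᵐ presets N U)
      reach′  : Reachable N′ (M′ +ᵐ presets N′ U′)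
      finite  : FinSupp H
      silent  : Silent N H
      marking : ∀ s → + (M s ℕ.+ presets N U s) ≡ base (M′ +ᵐ presets N′ U′) s ℤ.+ ⟦_⟧Σ N H s
  open Linked

  B : STMarking N → STMarking N′ → Set
  B (M , U) (M′ , U′) = ∃[ H ] Linked H M U M′ U′

  fΣ : Signed (Transition N) → ℤ
  fΣ G = finsum (λ t → G t ℤ.* + f t)

  -- Steps do not keep `H` in `NF`, so condition 4 is invoked anew at each use. Equality of the
  -- weights lets bounds found for the normal form carry over to `H`.
  normal-form : ∀ {H M U M′ U′} → Linked H M U M′ U′ →
                ∃[ H₁ ] (Linked H₁ M U M′ U′ × NF H₁ × fΣ H₁ ≡ fΣ H)
  normal-form {H} L with normalise H (FinSupp⇒Finite (finite L)) (silent L)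
  ... | H₁ , fin-H₁ , nf , silent-H₁ , ⟦H₁⟧≗⟦H⟧ , f≡ = H₁ , record
      { labels  = labels L
      ; reach   = reach L
      ; reach′  = reach′ L
      ; finite  = Finite⇒FinSupp fin-H₁
      ; silent  = silent-H₁
      ; marking = λ s → trans (marking L s) (cong (λ n → base _ s ℤ.+ n) (sym (⟦H₁⟧≗⟦H⟧ s)))
      } , nf , f≡

  -- Consequences of condition 5.

  Target : Multiset (Place N′) → List (Transition N′) → List (Transition N) →
           Signed (Transition N) → Signed (Place N)
  Target M′ U′ U H =
    E (⌊ M′ ⌋ +ˢ •Σ N′ ⌊ count U′ ⌋) +ˢ (⌊ M₀ N ⌋ -ˢ E ⌊ M₀ N′ ⌋) +ˢ ⟦_⟧Σ N H -ˢ •Σ N ⌊ count U ⌋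

  Target≡ : ∀ M′ U′ U H s →
    Target M′ U′ U H s ≡ base (M′ +ᵐ presets N′ U′) s ℤ.+ ⟦_⟧Σ N H s ℤ.- + presets N U s
  Target≡ M′ U′ U H s = cong₂ (λ a b → a ℤ.+ (+ M₀ N s ℤ.- E ⌊ M₀ N′ ⌋ s) ℤ.+ ⟦_⟧Σ N H s ℤ.- b)
    (extendBy-cong 0ℤ (λ s′ → cong (λ n → + M′ s′ ℤ.+ n) (•Σ-count N′ U′ s′)) s) (•Σ-count N U s)

  ℓΣ-labels : ∀ {U U′} → Pointwise SameLabel U U′ → ℓΣ N ⌊ count U ⌋ ≗ ℓΣ N′ ⌊ count U′ ⌋
  ℓΣ-labels {U} {U′} same α = trans (ext-count (λ t → ⌊ ⁅ ℓ N t ⁆ ⌋) U α)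
    (trans (pointwise same) (sym (ext-count (λ t → ⌊ ⁅ ℓ N′ t ⁆ ⌋) U′ α)))
    where
    pointwise : ∀ {U U′} → Pointwise SameLabel U U′ →
      Σℤ U (λ t → + ⁅ ℓ N t ⁆ α) ≡ Σℤ U′ (λ t → + ⁅ ℓ N′ t ⁆ α)
    pointwise []       = refl
    pointwise (r ∷ rs) = cong₂ ℤ._+_ (cong (λ β → + ⁅ β ⁆ α) r) (pointwise rs)

  -- Condition 5 for the multisets of running transitions. Neither `M` nor `H` is an argument, so
  -- the resulting upper bound stays the same along silent steps of `N`.
  bounds-for : ∀ {M′ U U′} → Pointwise SameLabel U U′ → Reachable N′ (M′ +ᵐ presets N′ U′) → _
  bounds-for {M′} {U} {U′} same r′ = bounds M′ (count U′) (count U)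
    (FinSupp⇒Finite (FinSupp-count U′)) (FinSupp⇒Finite (FinSupp-count U)) (ℓΣ-labels same)
    (M′ +ᵐ presets N′ U′) (λ s → cong (λ n → + M′ s ℤ.+ n) (sym (•Σ-count N′ U′ s))) r′

  -- H_{M′,U}
  Hᵐ : ∀ {M′ U U′} → Pointwise SameLabel U U′ → Reachable N′ (M′ +ᵐ presets N′ U′) →
       Multiset (Transition N)
  Hᵐ same r′ = proj₁ (bounds-for same r′)

  module _ {M′ U U′} (same : Pointwise SameLabel U U′) (r′ : Reachable N′ (M′ +ᵐ presets N′ U′)) where

    Hᵐ-finite : FinSupp ⌊ Hᵐ same r′ ⌋
    Hᵐ-finite = Finite⇒FinSupp (proj₁ (proj₂ (bounds-for same r′)))

    Hᵐ⊆T⁺ : ∀ t → Hᵐ same r′ t ≢ 0 → T⁺ t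
    Hᵐ⊆T⁺ = proj₁ (proj₂ (proj₂ (bounds-for same r′)))

    Hᵐ-silent : Silent N ⌊ Hᵐ same r′ ⌋
    Hᵐ-silent = proj₁ (proj₂ (proj₂ (proj₂ (bounds-for same r′))))

    module Facts {H M} (L : Linked H M U M′ U′) (nf : NF H) where

      K : Multiset (Place N)
      K = M +ᵐ presets N U

      Bs : Signed (Place N)
      Bs = base (M′ +ᵐ presets N′ U′)

      private
        facts = proj₂ (proj₂ (proj₂ (proj₂ (bounds-for same r′)))) H (FinSupp⇒Finite (finite L)) nf M
          (λ s → trans (a+b≡c⇒a≡c-b {b = + presets N U s} (marking L s)) (sym (Target≡ M′ U′ U H s)))
          K (λ s → cong (λ n → + M s ℤ.+ n) (sym (•Σ-count N U s))) (reach L)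

      target = proj₁ facts
      H≤Hᵐ = proj₁ (proj₂ facts)
      H⁻⇒T⁻ = proj₁ (proj₂ (proj₂ facts))
      H⁻-H⁺-disjoint = proj₁ (proj₂ (proj₂ (proj₂ facts)))
      H⁻-visible-disjoint = proj₁ (proj₂ (proj₂ (proj₂ (proj₂ facts))))
      concurrent-disjoint = proj₂ (proj₂ (proj₂ (proj₂ (proj₂ facts))))

      Mᵐ : Multiset (Place N)
      Mᵐ = proj₁ target

      Mᵐ≡ : ∀ s → + Mᵐ s ≡ + M s ℤ.+ (⟦_⟧Σ N ⌊ Hᵐ same r′ ⌋ s ℤ.- ⟦_⟧Σ N H s)
      Mᵐ≡ s = begin
        + Mᵐ s
          ≡⟨ proj₁ (proj₂ target) s ⟩
        Target M′ U′ U ⌊ Hᵐ same r′ ⌋ s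
          ≡⟨ Target≡ M′ U′ U ⌊ Hᵐ same r′ ⌋ s ⟩
        Bs s ℤ.+ Eᵐ ℤ.- + presets N U s
          ≡⟨ identity (Bs s) Eᵐ (⟦_⟧Σ N H s) (+ presets N U s) ⟩
        (Bs s ℤ.+ ⟦_⟧Σ N H s ℤ.- + presets N U s) ℤ.+ (Eᵐ ℤ.- ⟦_⟧Σ N H s)
          ≡⟨ cong (ℤ._+ (Eᵐ ℤ.- ⟦_⟧Σ N H s))
               (a+b≡c⇒a≡c-b {+ M s} {+ presets N U s} (marking L s)) ⟨
        + M s ℤ.+ (Eᵐ ℤ.- ⟦_⟧Σ N H s)
          ∎
        where
        open ≡-Reasoning
        Eᵐ = ⟦_⟧Σ N ⌊ Hᵐ same r′ ⌋ s
        identity : ∀ b e h p → b ℤ.+ e ℤ.- p ≡ (b ℤ.+ h ℤ.- p) ℤ.+ (e ℤ.- h)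
        identity = solve-∀

      H⁺ H⁻ : Multiset (Transition N)
      H⁺ = positivePart H
      H⁻ = negativePart H

      H⁺-finite : FinSupp ⌊ H⁺ ⌋
      H⁺-finite = FinSupp-positivePart (finite L)

      H⁻-finite : FinSupp ⌊ H⁻ ⌋
      H⁻-finite = FinSupp-negativePart (finite L)

      -- By (c), an entry that is positive in `H` is positive in `Hᵐ`.
      H⁺⊆T⁺ : ∀ t → + H⁺ t ≢ 0ℤ → T⁺ t
      H⁺⊆T⁺ t H⁺t≢0 = Hᵐ⊆T⁺ t λ Hᵐt≡0 →
        ℤ.<⇒≱ (positivePart≢0 H t (H⁺t≢0 ∘ cong +_)) (subst (λ n → H t ℤ.≤ + n) Hᵐt≡0 (H≤Hᵐ t))

      base+H⁺ : ∀ s → Bs s ℤ.+ ⟦_⟧Σ N ⌊ H⁺ ⌋ s ≡ + K s ℤ.+ ⟦_⟧Σ N ⌊ H⁻ ⌋ s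
      base+H⁺ s = begin
        Bs s ℤ.+ ⟦_⟧Σ N ⌊ H⁺ ⌋ s                       ≡⟨ cong (λ n → Bs s ℤ.+ n) (trans
                                                           (ext-cong (effect N) H⁺-finite (positive-negative H) s)
                                                           (ext-+ (effect N) (finite L) H⁻-finite s)) ⟩
        Bs s ℤ.+ (⟦_⟧Σ N H s ℤ.+ ⟦_⟧Σ N ⌊ H⁻ ⌋ s)      ≡⟨ ℤ.+-assoc (Bs s) (⟦_⟧Σ N H s) (⟦_⟧Σ N ⌊ H⁻ ⌋ s) ⟨
        Bs s ℤ.+ ⟦_⟧Σ N H s ℤ.+ ⟦_⟧Σ N ⌊ H⁻ ⌋ s        ≡⟨ cong (ℤ._+ ⟦_⟧Σ N ⌊ H⁻ ⌋ s) (marking L s) ⟨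
        + K s ℤ.+ ⟦_⟧Σ N ⌊ H⁻ ⌋ s                      ∎
        where open ≡-Reasoning

      0≤⟦⟧ : ∀ {G : Multiset (Transition N)} → FinSupp ⌊ G ⌋ → ∀ s → •Σ N ⌊ G ⌋ s ≡ 0ℤ → 0ℤ ℤ.≤ ⟦_⟧Σ N ⌊ G ⌋ s
      0≤⟦⟧ {G} fG s •G≡0 = subst (0ℤ ℤ.≤_)
        (sym (trans (⟦⟧-split fG s) (trans (cong (λ n → Σ• ⌊ G ⌋ s ℤ.- n) •G≡0) (ℤ.+-identityʳ _))))
        (0≤Σ• fG (λ _ → ℤ.+≤+ z≤n) s)

      -- By (e), `H⁺` consumes nothing from a preplace of `u`, so its effect there is nonnegative.
      0≤base+H⁺ : ∀ u s → H u ℤ.< 0ℤ → preset N u s ≢ 0 → 0ℤ ℤ.≤ Bs s ℤ.+ ⟦_⟧Σ N ⌊ H⁺ ⌋ s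
      0≤base+H⁺ u s Hu<0 •u≢0 = ℤ.+-mono-≤ (0≤base (M′ +ᵐ presets N′ U′) s) (0≤⟦⟧ H⁺-finite s
        (ext-0 (λ t → ⌊ preset N t ⌋) λ t H⁺t≢0 → cong +_ (Disjoint⇒≡0
          (H⁻-H⁺-disjoint u t Hu<0 (positivePart≢0 H t (H⁺t≢0 ∘ cong +_))) •u≢0)))

      -- Place by place. Where some `u` in `H⁻` consumes, `t` needs no token by (f). Elsewhere `H⁻`
      -- only produces, so `K + ⟦H⁻⟧` has at least the tokens of `K`.
      base+H⁺-enables : ∀ t → ℓ N t ≢ τ → (∀ s → preset N t s ≤ K s) →
                        ∀ s → + preset N t s ℤ.≤ Bs s ℤ.+ ⟦_⟧Σ N ⌊ H⁺ ⌋ s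
      base+H⁺-enables t visible en s with em {∃[ u ] (H u ℤ.< 0ℤ × preset N u s ≢ 0)}
      ... | yes (u , Hu<0 , •u≢0) = subst (λ n → + n ℤ.≤ Bs s ℤ.+ ⟦_⟧Σ N ⌊ H⁺ ⌋ s)
              (sym (Disjoint⇒≡0 (H⁻-visible-disjoint u t Hu<0 (Enabled⁅⁆ en) visible) •u≢0))
              (0≤base+H⁺ u s Hu<0 •u≢0)
      ... | no none = subst (+ preset N t s ℤ.≤_) (sym (base+H⁺ s))
              (subst (ℤ._≤ + K s ℤ.+ ⟦_⟧Σ N ⌊ H⁻ ⌋ s) (ℤ.+-identityʳ _)
                (ℤ.+-mono-≤ (ℤ.+≤+ (en s)) (0≤⟦⟧ H⁻-finite s (ext-0 (λ t → ⌊ preset N t ⌋) not-consumed))))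
        where
        not-consumed : ∀ u → + H⁻ u ≢ 0ℤ → + preset N u s ≡ 0ℤ
        not-consumed u H⁻u≢0 = cong +_ (decidable-stable (_ ℕ.≟ 0)
          (λ •u≢0 → none (u , negativePart≢0 H u (H⁻u≢0 ∘ cong +_) , •u≢0)))

      running-visible : ∀ {v} → v ∈ U → ℓ N v ≢ τ
      running-visible v∈U ℓv≡τ with Pointwise-∈ˡ same v∈U
      ... | v′ , ℓ≡ = ℓ′-visible v′ (trans (sym ℓ≡) ℓv≡τ)

      -- Each running transition is enabled in `K`, because `K` includes `•U`, and it is visible
      -- because `N′` is plain. Hence (f) applies to it.
      running-disjoint : ∀ u s → H u ℤ.< 0ℤ → preset N u s ≢ 0 → presets N U s ≡ 0
      running-disjoint u s Hu<0 •u≢0 = sum-map-0 _ U λ v v∈U → Disjoint⇒≡0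
        (H⁻-visible-disjoint u v Hu<0
          (Enabled⁅⁆ λ s → ℕ.≤-trans (∈⇒≤sum (λ t → preset N t s) v∈U) (ℕ.m≤n+m _ (M s)))
          (running-visible v∈U)) •u≢0

      -- The faithful origins of `t` give `•t′` within `M′ + •U′`. Since `t` is enabled in `M`, it
      -- is enabled in `K` concurrently with any running `u`; by (g) the partner of `u` in `U′`
      -- shares no preplace with `t′`, so the tokens needed come from `M′`.
      preset′≤M′ : ∀ t t′ → ℓ N t ≢ τ → ℓ N′ t′ ≡ ℓ N t → (∀ s → preset N t s ≤ M s) →
        (∀ s → fin (extendBy 0 ι (preset N′ t′) s) ≤⁺ faithfulOrigins N T⁺ S⁺ (inj₂ t) s) →
        ∀ s′ → preset N′ t′ s′ ≤ M′ s′
      preset′≤M′ t t′ visible ℓ≡ en ≤*t s′ with preset N′ t′ s′ ℕ.≟ 0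
      ... | yes e = subst (_≤ M′ s′) (sym e) z≤n
      ... | no •t′≢0 = subst (preset N′ t′ s′ ≤_)
              (trans (cong (M′ s′ ℕ.+_) others-disjoint) (ℕ.+-identityʳ _)) preset′≤K′
        where
        preset′≤K′ : preset N′ t′ s′ ≤ M′ s′ ℕ.+ presets N′ U′ s′
        preset′≤K′ = ℤ.drop‿+≤+ (subst₂ ℤ._≤_ (cong +_ (extendBy-∈ 0 (preset N′ t′) s′))
          (base-∈ (M′ +ᵐ presets N′ U′) s′)
          (faithful-tokens T⁺ S⁺ (base⊆S⁺ (M′ +ᵐ presets N′ U′)) H⁺-finite (λ _ → ℤ.+≤+ z≤n) H⁺⊆T⁺
            (base+H⁺-enables t visible (λ s → ℕ.≤-trans (en s) (ℕ.m≤m+n _ _)))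
            (0≤base (M′ +ᵐ presets N′ U′) (to s′)) (≤*t (to s′))))
        others-disjoint : presets N′ U′ s′ ≡ 0
        others-disjoint = sum-map-0 _ U′ λ u′ u′∈U′ → disjoint u′ (Pointwise-∈ʳ same u′∈U′)
          where
          disjoint : ∀ u′ → ∃[ u ] (u ∈ U × SameLabel u u′) → preset N′ u′ s′ ≡ 0
          disjoint u′ (u , u∈U , ℓu≡) = Disjoint⇒≡0 (concurrent-disjoint t u t′ u′
            (Enabled-pair λ s → ℕ.+-mono-≤ (en s) (∈⇒≤sum (λ v → preset N v s) u∈U)) ℓ≡ (sym ℓu≡)) •t′≢0

      silent-step : ∀ {u} → ℓ N u ≡ τ → (∀ s → preset N u s ≤ M s) → ∃[ p₁ ] STStep N (M , U) τ p₁
      silent-step {u} ℓu≡τ en =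
        (proj₁ (Enabled⁅⁆ en) , U) , (u , ℓu≡τ , proj₂ (Enabled⁅⁆ en)) , refl

      D : Signed (Transition N)
      D = ⌊ Hᵐ same r′ ⌋ -ˢ H

      -- Negative entries are dealt with first: once `H` is nonnegative, the support of `D` lies
      -- within that of `Hᵐ`, so its transitions are silent and belong to `T⁺`.
      progress : ∀ a → ActionEnabled N′ M′ (vis a) →
                 ActionEnabled N M (vis a) ⊎ ∃[ p₁ ] STStep N (M , U) τ p₁
      progress a a-enabled with em {∃[ u ] H u ℤ.< 0ℤ}
      ... | yes (u₀ , Hu₀<0) = inj₂ (silent-step (silent L u (λ e → ℤ.<-irrefl e Hu<0)) (proj₂ (proj₂ fires)))
        where
        fires : ∃[ u ] (+ H⁻ u ≢ 0ℤ × (∀ s → preset N u s ≤ M s))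
        fires = fireable M acyclic⁻ H⁻-finite (λ _ → ℤ.+≤+ z≤n)
          (λ t H⁻t≢0 → H⁻⇒T⁻ t (negativePart≢0 H t (H⁻t≢0 ∘ cong +_)))
          (u₀ , <0⇒negativePart≢0 H u₀ Hu₀<0 ∘ ℤ.+-injective)
          -- No running transition consumes from `s`, so `M` and `K` agree there, and `K + ⟦H⁻⟧`
          -- equals the nonnegative `Bs + ⟦H⁺⟧`.
          λ t s H⁻t≢0 •t≢0 → let Ht<0 = negativePart≢0 H t (H⁻t≢0 ∘ cong +_) in
            subst (λ n → 0ℤ ℤ.≤ + n ℤ.+ ⟦_⟧Σ N ⌊ H⁻ ⌋ s)
              (trans (cong (M s ℕ.+_) (running-disjoint t s Ht<0 •t≢0)) (ℕ.+-identityʳ _))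
              (subst (0ℤ ℤ.≤_) (base+H⁺ s) (0≤base+H⁺ t s Ht<0 •t≢0))
        u = proj₁ fires
        Hu<0 : H u ℤ.< 0ℤ
        Hu<0 = negativePart≢0 H u (proj₁ (proj₂ fires) ∘ cong +_)
      ... | no H≮0 with em {∃[ u ] D u ≢ 0ℤ}
      ...   | yes D≢0 = inj₂ (silent-step (D-silent u Du≢0) (proj₂ (proj₂ fires)))
        where
        D-finite : FinSupp D
        D-finite = FinSupp-- Hᵐ-finite (finite L)
        -- If `Hᵐ` were 0 at `t`, then `0 ≤ H t ≤ 0`, and `D t` would vanish.
        Hᵐ≢0 : ∀ t → D t ≢ 0ℤ → Hᵐ same r′ t ≢ 0
        Hᵐ≢0 t Dt≢0 Hᵐt≡0 = Dt≢0 (cong₂ (λ m h → + m ℤ.- h) Hᵐt≡0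
          (ℤ.≤-antisym (subst (λ n → H t ℤ.≤ + n) Hᵐt≡0 (H≤Hᵐ t)) (ℤ.≮⇒≥ (λ Ht<0 → H≮0 (t , Ht<0)))))
        D-silent : ∀ t → D t ≢ 0ℤ → ℓ N t ≡ τ
        D-silent t Dt≢0 = Hᵐ-silent t (Hᵐ≢0 t Dt≢0 ∘ ℤ.+-injective)
        ⟦D⟧ : ∀ s → ⟦_⟧Σ N D s ≡ ⟦_⟧Σ N ⌊ Hᵐ same r′ ⌋ s ℤ.- ⟦_⟧Σ N H s
        ⟦D⟧ s = a+b≡c⇒a≡c-b (trans (sym (ext-+ (effect N) D-finite (finite L) s))
          (ext-cong (effect N) (FinSupp-+ D-finite (finite L)) (λ t → identity (+ Hᵐ same r′ t) (H t)) s))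
          where
          identity : ∀ a b → (a ℤ.- b) ℤ.+ b ≡ a
          identity = solve-∀
        fires : ∃[ u ] (D u ≢ 0ℤ × (∀ s → preset N u s ≤ M s))
        fires = fireable M acyclic⁺ D-finite (λ t → ℤ.i≤j⇒0≤j-i (H≤Hᵐ t))
          (λ t Dt≢0 → Hᵐ⊆T⁺ t (Hᵐ≢0 t Dt≢0)) D≢0
          -- Here `M + ⟦D⟧` is `Mᵐ`, a multiset by (a).
          λ t s _ _ → subst (0ℤ ℤ.≤_) (trans (Mᵐ≡ s) (cong (λ n → + M s ℤ.+ n) (sym (⟦D⟧ s)))) (ℤ.+≤+ z≤n)
        u = proj₁ fires
        Du≢0 = proj₁ (proj₂ fires)
      -- Now `H` equals `Hᵐ`, so `M` equals `Mᵐ`, and (b) makes the action available at once.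
      ...   | no D≡0 with proj₂ (proj₂ target) a a-enabled
      ...     | M₁ , t , ℓt≡a , σ = inj₁ (M₁ , t , ℓt≡a , Step-≗ Mᵐ≗M σ)
        where
        Hᵐ≗H : ∀ t → + Hᵐ same r′ t ≡ H t
        Hᵐ≗H t = ℤ.i-j≡0⇒i≡j _ _ (decidable-stable em (λ Dt≢0 → D≡0 (t , Dt≢0)))
        Mᵐ≗M : Mᵐ ≗ M
        Mᵐ≗M s = ℤ.+-injective (trans (Mᵐ≡ s) (trans
          (cong (λ n → + M s ℤ.+ (n ℤ.- ⟦_⟧Σ N H s)) (ext-cong (effect N) Hᵐ-finite Hᵐ≗H s))
          (identity (+ M s) (⟦_⟧Σ N H s))))
          where
          identity : ∀ m h → m ℤ.+ (h ℤ.- h) ≡ m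
          identity = solve-∀

  -- Steps that preserve the relation.

  ¬τ′ : ∀ {M′ M′₁} → ¬ ActionStep N′ M′ τ M′₁
  ¬τ′ (t′ , ℓ≡τ , _) = ℓ′-visible t′ ℓ≡τ

  silent-Linked : ∀ {H M U M′ U′ M₁} → Linked H M U M′ U′ → (σ : ActionStep N M τ M₁) →
                  Linked (H +ˢ ⌊ ⁅ proj₁ σ ⁆ ⌋) M₁ U M′ U′
  silent-Linked {H} {M} {U} {M′} {U′} {M₁} L (t , ℓt≡τ , σ) = record
    { labels  = labels L
    ; reach   = step (reach L) (step⁅⁆ (λ s → ℕ.≤-trans (step⁅⁆-enabled σ s) (ℕ.m≤m+n _ _)) K₁≡)
    ; reach′  = reach′ L
    ; finite  = FinSupp-+ (finite L) (FinSupp-⁅⁆ t)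
    ; silent  = silent₁
    ; marking = λ s → trans (K₁≡ s) (trans (cong (ℤ._+ effect N t s) (marking L s))
        (trans (ℤ.+-assoc (base _ s) (⟦_⟧Σ N H s) (effect N t s)) (cong (λ n → base _ s ℤ.+ n) (sym (trans
          (ext-+ (effect N) (finite L) (FinSupp-⁅⁆ t) s)
          (cong (λ n → ⟦_⟧Σ N H s ℤ.+ n) (ext-⁅⁆ (effect N) t s)))))))
    }
    where
    K₁≡ : ∀ s → + (M₁ s ℕ.+ presets N U s) ≡ + (M s ℕ.+ presets N U s) ℤ.+ effect N t s
    K₁≡ s = trans (cong (ℤ._+ + presets N U s) (step⁅⁆-result σ s))
      (identity (+ M s) (effect N t s) (+ presets N U s))
      where
      identity : ∀ m e p → m ℤ.+ e ℤ.+ p ≡ m ℤ.+ p ℤ.+ e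
      identity = solve-∀
    silent₁ : Silent N (H +ˢ ⌊ ⁅ t ⁆ ⌋)
    silent₁ u ≢0 with em {t ≡ u}
    ... | yes refl = ℓt≡τ
    ... | no _     = silent L u λ Hu≡0 → ≢0 (cong (ℤ._+ 0ℤ) Hu≡0)

  -- Starting a transition moves its preset from the marking to the running part, so `M + •U` and
  -- `M′ + •U′` do not change and the same `H` serves.
  begin-Linked : ∀ {H M U M′ U′ M₁ a t} → Linked H M U M′ U′ → NF H → ℓ N t ≡ vis a →
    (∀ s → preset N t s ≤ M s) → (∀ s → + M₁ s ≡ + M s ℤ.- + preset N t s) →
    ∃[ q₁ ] (STStep N′ (M′ , U′) (vis (a begins)) q₁ × B (M₁ , U ++ t ∷ []) q₁)
  begin-Linked {H} {M} {U} {M′} {U′} {M₁} {a} {t} L nf ℓt≡a en M₁≡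
    with origins t (λ ℓt≡τ → contradiction (trans (sym ℓt≡a) ℓt≡τ) λ ())
  ... | t′ , ℓ≡ , ≤*t , _ = (M′₁ , U′ ++ t′ ∷ []) ,
        (t′ , trans ℓ≡ ℓt≡a , 𝒩′.Enabled⁅⁆ en′ , M′₁≡ , refl) , H , record
      { labels  = Pointwise.++⁺ (labels L) (sym ℓ≡ ∷ [])
      ; reach   = Reachable-≗ K≗ (reach L)
      ; reach′  = 𝒩′.Reachable-≗ K′≗ (reach′ L)
      ; finite  = finite L
      ; silent  = silent L
      ; marking = λ s → trans (cong +_ (sym (K≗ s))) (trans (marking L s)
                    (cong (ℤ._+ ⟦_⟧Σ N H s) (base-cong K′≗ s)))
      }
    where
    open Facts (labels L) (reach′ L) L nf using (preset′≤M′)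
    M′₁ : Multiset (Place N′)
    M′₁ s = M′ s ℕ.∸ preset N′ t′ s
    en′ : ∀ s → preset N′ t′ s ≤ M′ s
    en′ = preset′≤M′ t t′ (λ ℓt≡τ → contradiction (trans (sym ℓt≡a) ℓt≡τ) λ ()) ℓ≡ en ≤*t
    M′₁≡ : ∀ s → + M′₁ s ≡ + M′ s ℤ.- + preset N′ t′ s
    M′₁≡ s = pos-∸ (en′ s)
    moved : ∀ m p q {m₁ r : ℕ} → + m₁ ≡ + m ℤ.- + p → r ≡ q ℕ.+ p → m ℕ.+ q ≡ m₁ ℕ.+ r
    moved m p q e refl = ℤ.+-injective
      (trans (identity (+ m) (+ q) (+ p)) (cong (λ n → n ℤ.+ + (q ℕ.+ p)) (sym e)))
      where
      identity : ∀ m q p → m ℤ.+ q ≡ m ℤ.- p ℤ.+ (q ℤ.+ p)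
      identity = solve-∀
    K≗ : M +ᵐ presets N U ≗ M₁ +ᵐ presets N (U ++ t ∷ [])
    K≗ s = moved (M s) (preset N t s) (presets N U s) (M₁≡ s) (sum-map-++-[] (λ v → preset N v s) U t)
    K′≗ : M′ +ᵐ presets N′ U′ ≗ M′₁ +ᵐ presets N′ (U′ ++ t′ ∷ [])
    K′≗ s = moved (M′ s) (preset N′ t′ s) (presets N′ U′ s) (M′₁≡ s) (sum-map-++-[] (λ v → preset N′ v s) U′ t′)

  -- By condition 3, `⟦u′⟧ = ⟦u⟧ + ⟦G⟧`: the side of `N` gains `⟦u⟧` while the base gains
  -- `⟦u⟧ + ⟦G⟧`, and replacing `H` by `H - G` compensates.
  end-Linked : ∀ {H M U M′ U′} → Linked H M U M′ U′ → ∀ i i′ →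
    ℓ N (lookup U i) ≡ ℓ N′ (lookup U′ i′) → Pointwise SameLabel (removeAt U i) (removeAt U′ i′) →
    B (M +ᵐ postset N (lookup U i) , removeAt U i) (M′ +ᵐ postset N′ (lookup U′ i′) , removeAt U′ i′)
  end-Linked {H} {M} {U} {M′} {U′} L i i′ ℓ≡ rest
    with origins (lookup U i) (λ ℓ≡τ → ℓ′-visible (lookup U′ i′) (trans (sym ℓ≡) ℓ≡τ))
  ... | t′ , ℓt′≡ , _ , G , fin-G , silent-G , ⟦t′⟧≡ with ℓ′-injective (trans ℓt′≡ ℓ≡)
  -- Injectivity of the labelling identifies the transition given by condition 3 with the running
  -- `u′`.
  ...   | refl = H -ˢ ⌊ G ⌋ , record
      { labels  = rest
      -- The preset of `u` is still counted in `M + •U`, so its ending appears there as a full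
      -- firing of `u`.
      ; reach   = step (reach L) (step⁅⁆ {t = u} (presets≥ N U M i) (K₁≡ N U M i))
      ; reach′  = step (reach′ L) (𝒩′.step⁅⁆ {t = u′} (presets≥ N′ U′ M′ i′) (K₁≡ N′ U′ M′ i′))
      ; finite  = H-G-finite
      ; silent  = λ t ≢0 → silent₁ t ≢0 em
      ; marking = marking₁
      }
    where
    u = lookup U i
    u′ = lookup U′ i′
    presets≥ : ∀ (N : PetriNet Act) U (M : Multiset (Place N)) i s →
      preset N (lookup U i) s ≤ M s ℕ.+ presets N U s
    presets≥ N U M i s = ℕ.≤-trans (subst (preset N (lookup U i) s ≤_)
      (sym (sum-map-removeAt (λ v → preset N v s) U i)) (ℕ.m≤m+n _ _)) (ℕ.m≤n+m _ (M s))
    K₁≡ : ∀ (N : PetriNet Act) U (M : Multiset (Place N)) i s →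
      + (M s ℕ.+ postset N (lookup U i) s ℕ.+ presets N (removeAt U i) s)
        ≡ + (M s ℕ.+ presets N U s) ℤ.+ effect N (lookup U i) s
    K₁≡ N U M i s = trans
      (identity (+ M s) (+ postset N (lookup U i) s) (+ preset N (lookup U i) s) (+ presets N (removeAt U i) s))
      (cong (λ n → + (M s ℕ.+ n) ℤ.+ effect N (lookup U i) s) (sym (sum-map-removeAt (λ v → preset N v s) U i)))
      where
      identity : ∀ m a b r → m ℤ.+ a ℤ.+ r ≡ m ℤ.+ (b ℤ.+ r) ℤ.+ (a ℤ.- b)
      identity = solve-∀
    fG : FinSupp ⌊ G ⌋
    fG = Finite⇒FinSupp fin-G
    H-G-finite : FinSupp (H -ˢ ⌊ G ⌋)
    H-G-finite = FinSupp-- (finite L) fG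
    silent₁ : ∀ t → (H -ˢ ⌊ G ⌋) t ≢ 0ℤ → Dec (H t ≡ 0ℤ) → ℓ N t ≡ τ
    silent₁ t ≢0 (no Ht≢0)  = silent L t Ht≢0
    silent₁ t ≢0 (yes Ht≡0) = silent-G t λ Gt≡0 → ≢0 (cong₂ ℤ._-_ Ht≡0 Gt≡0)
    ⟦H-G⟧ : ∀ s → ⟦_⟧Σ N (H -ˢ ⌊ G ⌋) s ≡ ⟦_⟧Σ N H s ℤ.- ⟦_⟧Σ N ⌊ G ⌋ s
    ⟦H-G⟧ s = a+b≡c⇒a≡c-b (trans (sym (ext-+ (effect N) H-G-finite fG s))
      (ext-cong (effect N) (FinSupp-+ H-G-finite fG) (λ t → identity (H t) (+ G t)) s))
      where
      identity : ∀ a b → (a ℤ.- b) ℤ.+ b ≡ a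
      identity = solve-∀
    E-effect : ∀ s → E (effect N′ u′) s ≡ effect N u s ℤ.+ ⟦_⟧Σ N ⌊ G ⌋ s
    E-effect s = trans (⟦t′⟧≡ s) (trans (ext-+ (effect N) (FinSupp-⁅⁆ u) fG s)
      (cong (ℤ._+ ⟦_⟧Σ N ⌊ G ⌋ s) (ext-⁅⁆ (effect N) u s)))
    K′ = M′ +ᵐ presets N′ U′
    K′₁ = M′ +ᵐ postset N′ u′ +ᵐ presets N′ (removeAt U′ i′)
    base₁ : ∀ s → base K′₁ s ≡ base K′ s ℤ.+ (effect N u s ℤ.+ ⟦_⟧Σ N ⌊ G ⌋ s)
    base₁ s = trans
      (cong (ℤ._+ _) (trans (extendBy-cong 0ℤ (K₁≡ N′ U′ M′ i′) s)
        (trans (extendBy-+ ⌊ K′ ⌋ (effect N′ u′) s) (cong (λ n → E ⌊ K′ ⌋ s ℤ.+ n) (E-effect s)))))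
      (identity (E ⌊ K′ ⌋ s) (effect N u s ℤ.+ ⟦_⟧Σ N ⌊ G ⌋ s) (+ M₀ N s ℤ.- E ⌊ M₀ N′ ⌋ s))
      where
      identity : ∀ k e m → k ℤ.+ e ℤ.+ m ≡ k ℤ.+ m ℤ.+ e
      identity = solve-∀
    marking₁ : ∀ s → + (M s ℕ.+ postset N u s ℕ.+ presets N (removeAt U i) s)
               ≡ base K′₁ s ℤ.+ ⟦_⟧Σ N (H -ˢ ⌊ G ⌋) s
    marking₁ s = begin
      + (M s ℕ.+ postset N u s ℕ.+ presets N (removeAt U i) s)   ≡⟨ K₁≡ N U M i s ⟩
      + (M s ℕ.+ presets N U s) ℤ.+ e                            ≡⟨ cong (ℤ._+ e) (marking L s) ⟩
      b ℤ.+ h ℤ.+ e                                              ≡⟨ identity b h e g ⟩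
      b ℤ.+ (e ℤ.+ g) ℤ.+ (h ℤ.- g)                              ≡⟨ cong₂ ℤ._+_ (base₁ s) (⟦H-G⟧ s) ⟨
      base K′₁ s ℤ.+ ⟦_⟧Σ N (H -ˢ ⌊ G ⌋) s                       ∎
      where
      open ≡-Reasoning
      e = effect N u s
      b = base K′ s
      h = ⟦_⟧Σ N H s
      g = ⟦_⟧Σ N ⌊ G ⌋ s
      identity : ∀ b h e g → b ℤ.+ h ℤ.+ e ≡ b ℤ.+ (e ℤ.+ g) ℤ.+ (h ℤ.- g)
      identity = solve-∀

  B-resp : ∀ {p p₁ q q₁} → LTS._≈_ (ST-LTS N) p p₁ → LTS._≈_ (ST-LTS N′) q q₁ → B p q → B p₁ q₁
  B-resp (e , refl) (e′ , refl) (H , L) = H , record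
    { labels  = labels L
    ; reach   = Reachable-≗ (λ s → cong (ℕ._+ _) (e s)) (reach L)
    ; reach′  = 𝒩′.Reachable-≗ (λ s → cong (ℕ._+ _) (e′ s)) (reach′ L)
    ; finite  = finite L
    ; silent  = silent L
    ; marking = λ s → trans (cong (λ n → + (n ℕ.+ _)) (sym (e s))) (trans (marking L s)
                  (cong (ℤ._+ _) (base-cong (λ s′ → cong (ℕ._+ _) (e′ s′)) s)))
    }

  -- Steps of `N` matched by `N′`.

  follow-τ : ∀ {p q p₁} → B p q → STStep N p τ p₁ → B p₁ q
  follow-τ (H , L) (σ , refl) = _ , silent-Linked L σ

  follow : ∀ {p q η p₁} → B p q → STStep N p (vis η) p₁ → ∃[ q₁ ] (STStep N′ q (vis η) q₁ × B p₁ q₁)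
  follow {η = a begins} (_ , L) (t , ℓt≡a , (_ , σ) , M₁≡ , refl) with normal-form L
  ... | _ , L₁ , nf , _ = begin-Linked L₁ nf ℓt≡a (step⁅⁆-enabled σ) M₁≡
  follow {q = M′ , U′} {η = a ends n} (_ , L) (i , i≡n , ℓ≡a , refl , M₁≗) with Pointwise-removeAt (labels L) i
  ... | i′ , i≡i′ , ℓ≡ , rest =
        (M′ +ᵐ postset N′ (lookup U′ i′) , removeAt U′ i′)
      , (i′ , trans (cong suc (sym i≡i′)) i≡n , trans (sym ℓ≡) ℓ≡a , refl , λ _ → refl)
      , B-resp ((λ s → sym (M₁≗ s)) , refl) ((λ _ → refl) , refl) (end-Linked L i i′ ℓ≡ rest)

  transfer : Transfer (ST-LTS N) (ST-LTS N′) B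
  transfer {q = q} {τ} b σ = q , q , ε , inj₂ (refl , (λ _ → refl) , refl) , b , follow-τ b σ
  transfer {q = q} {vis _} b σ with follow b σ
  ... | q₁ , σ′ , b₁ = q , q₁ , ε , inj₁ σ′ , b , b₁

  -- Termination of silent steps.

  fΣ-⁅⁆ : ∀ {H} t → FinSupp H → fΣ (H +ˢ ⌊ ⁅ t ⁆ ⌋) ≡ fΣ H ℤ.+ + f t
  -- The weight is treated as an additive extension with values over a one-element set, whose point
  -- is `tt`.
  fΣ-⁅⁆ {H} t fH = trans (ext-+ (λ u _ → + f u) fH (FinSupp-⁅⁆ t) tt)
                     (cong (λ n → fΣ H ℤ.+ n) (ext-⁅⁆ (λ u _ → + f u) t tt))

  -- The normal form of `H` has the same weight and lies below `Hᵐ` by (c); the weights `f t` are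
  -- nonnegative.
  fΣ-bounded : ∀ {M′ U U′} (same : Pointwise SameLabel U U′) (r′ : Reachable N′ (M′ +ᵐ presets N′ U′)) →
               ∀ {H M} → Linked H M U M′ U′ → fΣ H ℤ.≤ fΣ ⌊ Hᵐ same r′ ⌋
  fΣ-bounded same r′ {H} L with normal-form L
  ... | H₁ , L₁ , nf , f≡ = subst (ℤ._≤ fΣ ⌊ Hᵐ same r′ ⌋) f≡ (finsum-mono
        (FinSupp-* (λ u _ → + f u) (finite L₁) tt) (FinSupp-* (λ u _ → + f u) (Hᵐ-finite same r′) tt)
        λ t → ℤ.*-monoʳ-≤-nonNeg (+ f t) (Facts.H≤Hᵐ same r′ L₁ nf t))

  _τ⇐_ : STMarking N → STMarking N → Set
  p₁ τ⇐ p = STStep N p τ p₁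

  -- Induction on a number `n` bounding the distance of the weight from its upper bound `b`, which
  -- is fixed because silent steps leave `U`, `M′` and `U′` alone. Each silent step adds `f t`,
  -- hence at least 1, to the weight.
  terminating : ∀ {p q} → B p q → Acc _τ⇐_ p
  terminating {M , U} {M′ , U′} (H , L) = go ∣ gap ∣ L
    (subst (λ n → b ℤ.≤ n ℤ.+ fΣ H) (sym (ℤ.0≤i⇒+∣i∣≡i (ℤ.i≤j⇒0≤j-i (fΣ-bounded (labels L) (reach′ L) L))))
      (ℤ.≤-reflexive (identity b (fΣ H))))
    where
    b gap : ℤ
    b = fΣ ⌊ Hᵐ (labels L) (reach′ L) ⌋
    gap = b ℤ.- fΣ H
    identity : ∀ b h → b ≡ b ℤ.- h ℤ.+ h
    identity = solve-∀
    go : ∀ n {H M} → Linked H M U M′ U′ → b ℤ.≤ + n ℤ.+ fΣ H → Acc _τ⇐_ (M , U)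
    go n {H} {M} L₁ b≤ = acc λ { (σ , refl) → next n σ (silent-Linked L₁ σ) b≤ }
      where
      next : ∀ n {M₁} (σ : ActionStep N M τ M₁) → Linked (H +ˢ ⌊ ⁅ proj₁ σ ⁆ ⌋) M₁ U M′ U′ →
             b ℤ.≤ + n ℤ.+ fΣ H → Acc _τ⇐_ (M₁ , U)
      -- The weight has already reached `b`, so one more silent step would exceed it.
      next zero (t , _) L₂ b≤ = contradiction
        (ℤ.≤-trans (fΣ-bounded (labels L) (reach′ L) L₂) (subst (b ℤ.≤_) (ℤ.+-identityˡ (fΣ H)) b≤))
        (ℤ.<⇒≱ (subst₂ ℤ._<_ (ℤ.+-identityʳ (fΣ H)) (sym (fΣ-⁅⁆ t (finite L₁)))
          (ℤ.+-monoʳ-< (fΣ H) (ℤ.+<+ (0<f t)))))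
      next (suc n) (t , _) L₂ b≤ = go n L₂ (ℤ.≤-trans b≤ (subst₂ ℤ._≤_ (regroup (+ n) (fΣ H))
        (cong (λ k → + n ℤ.+ k) (sym (fΣ-⁅⁆ t (finite L₁))))
        (ℤ.+-monoʳ-≤ (+ n) (ℤ.+-monoʳ-≤ (fΣ H) (ℤ.+≤+ (0<f t))))))
        where
        regroup : ∀ n h → n ℤ.+ (h ℤ.+ ℤ.1ℤ) ≡ ℤ.1ℤ ℤ.+ n ℤ.+ h
        regroup = solve-∀

  no-chain : ∀ {p} → Acc _τ⇐_ p → (ps : ℕ → STMarking N) → ps 0 ≡ p →
             ¬ (∀ k → STStep N (ps k) τ (ps (suc k)))
  no-chain (acc rs) ps refl chain = no-chain (rs (chain 0)) (ps ∘ suc) refl (chain ∘ suc)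

  catch-up : ∀ {p q η q₁} → Acc _τ⇐_ p → B p q → STStep N′ q (vis η) q₁ →
    ∃[ p† ] ∃[ p₁ ] (LTS._⟹_ (ST-LTS N) p p† × STStep N p† (vis η) p₁ × B p† q × B p₁ q₁)
  catch-up {p} {q} {η} {q₁} (acc rs) b σ′ with attempt η b σ′
    where
    attempt : ∀ {p q} η {q₁} → B p q → STStep N′ q (vis η) q₁ →
              (∃[ p₁ ] STStep N p (vis η) p₁) ⊎ (∃[ p₁ ] STStep N p τ p₁)
    attempt {M , U} (a begins) (_ , L) (t′ , ℓ≡ , (_ , σ′) , _) with normal-form L
    ... | _ , L₁ , nf , _ with Facts.progress (labels L₁) (reach′ L₁) L₁ nf a (_ , t′ , ℓ≡ , σ′)
    ...   | inj₁ (_ , t , ℓt≡a , σ) = inj₁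
            ( ((λ s → M s ℕ.∸ preset N t s) , U ++ t ∷ [])
            , t , ℓt≡a , (_ , σ) , (λ s → pos-∸ (step⁅⁆-enabled σ s)) , refl)
    ...   | inj₂ σ = inj₂ σ
    -- An ending never has to wait: the two lists carry equal labels at equal positions.
    attempt {M , U} (a ends n) (_ , L) (i′ , i≡n , ℓ≡a , _)
      with Pointwise-removeAt (Pointwise.symmetric sym (labels L)) i′
    ... | i , i′≡i , ℓ≡ , _ = inj₁
          ( (M +ᵐ postset N (lookup U i) , removeAt U i)
          , i , trans (cong suc (sym i′≡i)) i≡n , trans (sym ℓ≡) ℓ≡a , refl , λ _ → refl)
  ... | inj₁ (p₁ , σ) with follow b σ
  -- The answer of `N′` to `σ` is its given step, up to equality of states, by determinism.
  ...   | q₂ , σ₂ , b₁ = p , p₁ , ε , σ , b ,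
          B-resp ((λ _ → refl) , refl) (STStep-deterministic ℓ′-injective σ₂ σ′) b₁
    where open Deterministic em
  catch-up {p} {q} {η} {q₁} (acc rs) b σ′ | inj₂ (p₁ , σ) with catch-up (rs σ) (follow-τ b σ) σ′
  ... | p† , p₂ , ⟹p† , σ₂ , b† , b₂ = p† , p₂ , σ ◅ ⟹p† , σ₂ , b† , b₂

  transfer⁻¹ : Transfer (ST-LTS N′) (ST-LTS N) (λ q p → B p q)
  transfer⁻¹ {α = τ}     b (σ , _) = contradiction σ ¬τ′
  transfer⁻¹ {α = vis _} b σ =
    let p† , p₁ , ⟹p† , σ₁ , b† , b₁ = catch-up (terminating b) b σ
    in  p† , p₁ , ⟹p† , inj₁ σ₁ , b† , b₁
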